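{- Let $D_S$ be a digraph with self-loops of order $n$ with $\sigma$ self-loops. Let $D_1,\dots,D_k$ be its strong components, where $D_i$ has order $n_i$ and $\sigma_i$ self-loops, such that $n=\sum_{i=1}^k n_i$ and $\sigma=\sum_{i=1}^k\sigma_i$, and let $\lambda_{i,1},\dots,\lambda_{i,n_i}$ be the eigenvalues of $A(D_i)$. Let $1\le l<k$ and suppose that $\frac{\sigma_i}{n_i}>\frac{\sigma}{n}$ for $i=1,\dots,l$ and $\frac{\sigma_i}{n_i}\le\frac{\sigma}{n}$ for $i=l+1,\dots,k$. For each $i$ let $$B_i=\left\{j\in\{1,\dots,n_i\}:\Re(\lambda_{i,j})>\frac{\sigma_i}{n_i}\right\}.$$ Then $$E(D_S)\le\sum_{i=1}^kE(D_i)\quad\Longrightarrow\quad\sum_{i=1}^l\left(\frac{\sigma_i}{n_i}-\frac{\sigma}{n}\right)|B_i|\le\sum_{i=l+1}^k\left(\frac{\sigma}{n}-\frac{\sigma_i}{n_i}\right)|B_i|.$$ If the inequality on the left-hand side of the implication is strict, then the inequality on the right-hand side is also strict.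
   Context: A digraph with self-loops $D_S$ is a pair $(V,\mathcal A)$ with $V$ a nonempty finite vertex set and $\mathcal A\subseteq V\times V$ a set of arcs; $S=\{v\in V:(v,v)\in\mathcal A\}$ is the self-loop set (possibly empty). The order is $n=|V|$ and the number of self-loops is $\sigma=|S|$. The adjacency matrix $A(D_S)=(a_{ij})$ has $a_{ij}=1$ if $(v_i,v_j)\in\mathcal A$ and $a_{ij}=0$ otherwise; eigenvalues are counted with algebraic multiplicity. The energy of a digraph with self-loops of order $n$ with $\sigma$ self-loops and eigenvalues $\lambda_1,\dots,\lambda_n$ is $\sum_{i=1}^n\left|\Re(\lambda_i)-\frac{\sigma}{n}\right|$; in particular $E(D_i)=\sum_{j=1}^{n_i}\left|\Re(\lambda_{i,j})-\frac{\sigma_i}{n_i}\right|$. A digraph is strongly connected if for any two distinct vertices $v,w$ there is a path from $v$ to $w$ and one from $w$ to $v$; a strong component is a maximal strongly connected sub-digraph (self-loops included). -}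

module Defs where

open import Level using (0ℓ; suc)
open import Algebra.Bundles using (CommutativeRing; RawRing)
import Algebra.Definitions.RawMonoid as RawMonoidDefs
open import Data.Bool using (Bool; true; if_then_else_)
open import Data.Fin using (Fin; punchIn; toℕ) renaming (zero to fzero; suc to fsuc)
open import Data.Fin.Properties using (_≟_)
open import Data.Fin.Subset using (Subset; ∣_∣)
open import Data.Nat.Base using (ℕ; NonZero; +-0-rawMonoid)
open import Data.Product using (_×_; _,_; ∃; ∃-syntax; proj₁; proj₂)
open import Data.Sum using (_⊎_)
open import Data.Vec using (tabulate)
open import Data.Vec.Functional using (Vector)
open import Function.Definitions using (Injective)
open import Relation.Binary.Core using (Rel)
open import Relation.Binary.Construct.Closure.ReflexiveTransitive using (Star)
open import Relation.Binary.PropositionalEquality using (_≡_; _≢_)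
open import Relation.Binary.Structures using (IsStrictTotalOrder)
open import Relation.Nullary using (does)

-- The library has no real numbers, so ℝ is given axiomatically, as a
-- Dedekind-complete ordered field; classically such a field is unique up to
-- isomorphism.  Trichotomy is the classical one, hence the order is decidable.
-- The inverse is total, with an unspecified value at 0#.
record Reals : Set (suc 0ℓ) where
  infix 4 _<_ _≤_ _>_
  infix 8 _⁻¹
  field
    commutativeRing : CommutativeRing 0ℓ 0ℓ
  open CommutativeRing commutativeRing public
  field
    _<_                : Rel Carrier 0ℓ
    isStrictTotalOrder : IsStrictTotalOrder _≈_ _<_
    +-monoʳ-<          : ∀ z {x y} → x < y → z + x < z + y
    *-pos              : ∀ {x y} → 0# < x → 0# < y → 0# < x * y
    0≉1                : 0# ≉ 1#
    _⁻¹                : Carrier → Carrier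
    ⁻¹-inverseʳ        : ∀ {x} → x ≉ 0# → x * x ⁻¹ ≈ 1#

  open IsStrictTotalOrder isStrictTotalOrder public
    using (compare; _<?_)

  _>_ : Rel Carrier 0ℓ
  x > y = y < x

  _≤_ : Rel Carrier 0ℓ
  x ≤ y = x < y ⊎ x ≈ y

  UpperBound : (Carrier → Set) → Carrier → Set
  UpperBound P b = ∀ x → P x → x ≤ b

  field
    supremum : (P : Carrier → Set) → ∃ P → ∃ (UpperBound P) →
               ∃[ s ] UpperBound P s × (∀ b → UpperBound P b → s ≤ b)

  open RawMonoidDefs +-rawMonoid public
    using (sum) renaming (_×_ to _times_)

  ∣_∣ᵣ : Carrier → Carrier
  ∣ x ∣ᵣ = if does (x <? 0#) then - x else x

  _/ₙ_ : ℕ → ℕ → Carrier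
  a /ₙ b = (a times 1#) * (b times 1#) ⁻¹

  sumWhere : ∀ {k} → (Fin k → Bool) → Vector Carrier k → Carrier
  sumWhere p f = sum (λ i → if p i then f i else 0#)

sumℕ : ∀ {k} → Vector ℕ k → ℕ
sumℕ = RawMonoidDefs.sum +-0-rawMonoid

-- A pair (a , b) is a + bi.
complexRawRing : Reals → RawRing 0ℓ 0ℓ
complexRawRing R = record
  { Carrier = Carrier × Carrier
  ; _≈_     = λ (a , b) (c , d) → a ≈ c × b ≈ d
  ; _+_     = λ (a , b) (c , d) → a + c , b + d
  ; _*_     = λ (a , b) (c , d) → a * c + - (b * d) , a * d + b * c
  ; -_      = λ (a , b) → - a , - b
  ; 0#      = 0# , 0#
  ; 1#      = 1# , 0#
  } where open Reals R

ℂ : Reals → Set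
ℂ R = RawRing.Carrier (complexRawRing R)

module Matrices (K : RawRing 0ℓ 0ℓ) where
  open RawRing K
  open RawMonoidDefs +-rawMonoid using (sum)
  open RawMonoidDefs *-rawMonoid using () renaming (sum to product)

  Matrix : ℕ → Set
  Matrix n = Fin n → Fin n → Carrier

  sign : ∀ {n} → Fin n → Carrier
  sign fzero    = 1#
  sign (fsuc i) = - sign i

  -- Laplace expansion along the first row.
  det : ∀ {n} → Matrix n → Carrier
  det {ℕ.zero}  M = 1#
  det {ℕ.suc n} M =
    sum (λ j → sign j * (M fzero j * det (λ r c → M (fsuc r) (punchIn j c))))

  charPoly : ∀ {n} → Matrix n → Carrier → Carrier
  charPoly M x = det (λ i j → (if does (i ≟ j) then x else 0#) + - M i j)

  -- lam lists the eigenvalues of M with algebraic multiplicity.  Over an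
  -- infinite field, polynomials and polynomial functions are the same.
  AreEigenvalues : ∀ {n} → Matrix n → Vector Carrier n → Set
  AreEigenvalues M lam = ∀ x → charPoly M x ≈ product (λ j → x + - lam j)

record Digraph : Set where
  field
    order    : ℕ
    nonEmpty : NonZero order
    arc      : Fin order → Fin order → Bool

  Arc : Rel (Fin order) 0ℓ
  Arc v w = arc v w ≡ true

  selfLoops : Subset order
  selfLoops = tabulate (λ v → arc v v)

  σ : ℕ
  σ = ∣ selfLoops ∣

  StronglyConnected : Set
  StronglyConnected = ∀ v w → v ≢ w → Star Arc v w × Star Arc w v

open Digraph using (order; σ; StronglyConnected)

-- A sub-digraph of D together with an enumeration of its vertices, which is
-- needed to write down its adjacency matrix.  It need not be induced.
record SubDigraph (D : Digraph) : Set where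
  field
    digraph          : Digraph
    vertex           : Fin (order digraph) → Fin (order D)
    vertex-injective : Injective _≡_ _≡_ vertex
    vertex-arc       : ∀ {v w} → Digraph.Arc digraph v w →
                       Digraph.Arc D (vertex v) (vertex w)

  HasVertex : Fin (order D) → Set
  HasVertex v = ∃[ a ] vertex a ≡ v

  HasArc : Rel (Fin (order D)) 0ℓ
  HasArc v w =
    ∃[ a ] ∃[ b ] vertex a ≡ v × vertex b ≡ w × Digraph.Arc digraph a b

open SubDigraph public using (digraph)

module _ {D : Digraph} where
  open SubDigraph using (HasVertex; HasArc)

  infix 4 _⊑_

  _⊑_ : Rel (SubDigraph D) 0ℓ
  H ⊑ K = (∀ v → HasVertex H v → HasVertex K v) ×
          (∀ v w → HasArc H v w → HasArc K v w)

  IsStrongComponent : SubDigraph D → Set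
  IsStrongComponent H =
    StronglyConnected (digraph H) ×
    (∀ K → StronglyConnected (digraph K) → H ⊑ K → K ⊑ H)

-- The sub-digraphs C i are the strong components of D, each listed once.
AreStrongComponents : (D : Digraph) {k : ℕ} → (Fin k → SubDigraph D) → Set
AreStrongComponents D C =
  (∀ i → IsStrongComponent (C i)) ×
  (∀ H → IsStrongComponent H → ∃[ i ] H ⊑ C i × C i ⊑ H) ×
  (∀ i j → C i ⊑ C j → C j ⊑ C i → i ≡ j)

module Energy (R : Reals) where
  open Reals R
  open Matrices (complexRawRing R) public using (AreEigenvalues)
  open Matrices (complexRawRing R) using (Matrix)

  ℜ : ℂ R → Carrier
  ℜ = proj₁

  adjacency : (D : Digraph) → Matrix (order D)
  adjacency D i j = (if Digraph.arc D i j then 1# else 0#) , 0#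

  -- σ / n
  loopDensity : Digraph → Carrier
  loopDensity D = σ D /ₙ order D

  energy : (D : Digraph) → Vector (ℂ R) (order D) → Carrier
  energy D lam = sum (λ j → ∣ ℜ (lam j) + - loopDensity D ∣ᵣ)

  B : (D : Digraph) → Vector (ℂ R) (order D) → Subset (order D)
  B D lam = tabulate (λ j → does (loopDensity D <? ℜ (lam j)))

-- Ordering the strong components so that arcs only lead to earlier ones makes
-- the adjacency matrix block triangular, so its characteristic polynomial is
-- the product of those of the components and the spectrum of D is the union of
-- the spectra of the components.  Write a = σ/n and b = σᵢ/nᵢ.  Every eigenvalue
-- with real part p satisfies |p − a| ≥ |p − b| ± (b − a), with + if p > b and
-- − otherwise.  Summing, E(D) ≥ Σ E(Dᵢ) + Σ (2|Bᵢ| − nᵢ)(b − a), and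
-- Σ nᵢ(b − a) = σ − n·a = 0, hence E(D) ≥ Σ E(Dᵢ) + 2 Σ (b − a)|Bᵢ|.
module Submission where

open import Defs
open import Level using (0ℓ)
open import Algebra.Bundles using (CommutativeMonoid; CommutativeRing; RawRing)
import Algebra.Properties.AbelianGroup as AbelianGroupProperties
import Algebra.Properties.CommutativeMonoid.Sum as Summation
import Algebra.Properties.Group as GroupProperties
import Algebra.Properties.Monoid.Mult as MonoidMultiples
import Algebra.Properties.Ring as RingProperties
import Algebra.Properties.Semiring.Mult.TCOptimised as Multiples
import Algebra.Properties.Semiring.Sum as SemiringSummation
import Algebra.Solver.Ring as RingSolver
open import Algebra.Solver.Ring.AlmostCommutativeRing using (fromCommutativeRing; _-Raw-AlmostCommutative⟶_; Induced-equivalence)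
open import Data.Bool using (Bool; true; false; if_then_else_; not)
open import Data.Bool.Properties using (⇔→≡)
open import Data.Fin using (Fin; zero; suc; punchIn; punchOut; inject₁; lift; toℕ; _↑ˡ_; _↑ʳ_)
open import Data.Fin.Induction using (<-weakInduction; spo-wellFounded)
open import Data.Fin.Properties as Fin using (_≟_; suc-injective)
open import Data.Fin.Subset as Subset using (Subset; _∈_; _∉_; Nonempty; ∣_∣)
open import Data.Fin.Subset.Induction using (⊂-wellFounded)
open import Data.Fin.Subset.Properties as Subset using (_∈?_)
open import Data.Integer as ℤ using (ℤ; -[1+_])
import Data.Integer.Properties as ℤ
open import Data.List as List using (List)
open import Data.List.Relation.Unary.All as All using (All)
import Data.List.Relation.Unary.All.Properties as All
open import Data.Maybe using (just; nothing)
open import Data.Nat as ℕ using (ℕ; zero; suc; _<ᵇ_)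
import Data.Nat.Properties as ℕ
open import Data.Product using (_×_; _,_; ∃-syntax; proj₁; proj₂)
open import Data.Sum using (_⊎_; inj₁; inj₂)
open import Data.Unit using (⊤; tt)
open import Data.Vec as Vec using (Vec; lookup; _[_]≔_; tabulate)
import Data.Vec.Properties as Vec
open import Data.Vec.Functional using (Vector; updateAt; insertAt; removeAt; _++_)
open import Data.Vec.Functional.Properties using (updateAt-updates; updateAt-minimal; insertAt-lookup; insertAt-punchIn; lookup-++ˡ; lookup-++ʳ)
open import Effect.Monad using (RawMonad)
open import Function using (_∘_; const; case_of_)
open import Function.Bundles using (mk⇔)
open import Function.Definitions using (Injective)
open import Induction.WellFounded using (Acc; acc)
open import Relation.Binary.Construct.Closure.ReflexiveTransitive using (Star; ε; _◅_; _◅◅_; gmap)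
open import Relation.Binary.Core using (Rel)
open import Relation.Binary.Definitions using (Decidable; WeaklyDecidable; tri<; tri≈; tri>)
open import Relation.Binary.PropositionalEquality as ≡ using (_≡_; _≢_)
import Relation.Binary.Reasoning.Setoid as SetoidReasoning
open import Relation.Binary.Structures using (IsStrictPartialOrder; IsStrictTotalOrder)
open import Relation.Nullary using (Dec; does; yes; no; ¬_; contradiction)
open import Relation.Nullary.Decidable using (dec-true; dec-false; decidable-stable; _×-dec_; ¬?; ¬¬-excluded-middle)
open import Relation.Nullary.Negation using (¬¬-Monad; ¬¬-map; DoubleNegation)
import Relation.Unary as Unary

-- Ring normalisation

-- The vertices of a component lie scattered in the vertex set, whereas `det` expands along the
-- first row. Making the matrix literally block triangular would require the effect of row and
-- column permutations on `det`. Instead, the entries of one diagonal block are varied while the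
-- other rows stay fixed. This gives an alternating form of the block, and uniqueness of such forms
-- splits off the factor `det block` wherever the block sits.
--
-- Eigenvalue lists are known only through equal values of functions of `x`. Passing from equal
-- products of linear factors to equal multisets of roots therefore needs an infinite domain, and
-- the result is recorded as an equality of sums over the roots.
--
-- The two sides of the conclusion differ by exactly the sum of `(b - a)` times the cardinality of
-- `B` over all components. Both implications thus amount to reading off the sign of this number
-- from the final estimate.

module IntegerSolver (K : CommutativeRing 0ℓ 0ℓ) where
  open CommutativeRing K
  open Multiples semiring using (×-homo-+; ×1-homo-*; 1+×) renaming (_×_ to _·_)
  open RingProperties ring using (-‿distribˡ-*; -‿distribʳ-*)
  open GroupProperties +-group using () renaming (ε⁻¹≈ε to -0≈0; ⁻¹-involutive to -‿involutive)
  open AbelianGroupProperties +-abelianGroup using () renaming (⁻¹-∙-comm to -‿+-comm)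
  open SetoidReasoning setoid

  -- With this form of multiple, `1 · 1#` reduces to `1#`, so the constants 0 and 1 in solver
  -- expressions are `0#` and `1#` by computation.
  fromℤ : ℤ → Carrier
  fromℤ (ℤ.+ n)   = n · 1#
  fromℤ -[1+ n ] = - (suc n · 1#)

  fromℤ-⊖ : ∀ m n → fromℤ (m ℤ.⊖ n) ≈ m · 1# + - (n · 1#)
  fromℤ-⊖ zero    zero    = sym (-‿inverseʳ 0#)
  fromℤ-⊖ zero    (suc n) = sym (+-identityˡ _)
  fromℤ-⊖ (suc m) zero    = sym (trans (+-congˡ -0≈0) (+-identityʳ _))
  fromℤ-⊖ (suc m) (suc n) = begin
    fromℤ (suc m ℤ.⊖ suc n)                   ≡⟨ ≡.cong fromℤ (ℤ.[1+m]⊖[1+n]≡m⊖n m n) ⟩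
    fromℤ (m ℤ.⊖ n)                           ≈⟨ fromℤ-⊖ m n ⟩
    m · 1# + - (n · 1#)                       ≈⟨ +-congʳ (+-identityʳ _) ⟨
    m · 1# + 0# + - (n · 1#)                  ≈⟨ +-congʳ (+-congˡ (-‿inverseʳ 1#)) ⟨
    m · 1# + (1# + - 1#) + - (n · 1#)         ≈⟨ +-congʳ (+-assoc _ _ _) ⟨
    m · 1# + 1# + - 1# + - (n · 1#)           ≈⟨ +-assoc _ _ _ ⟩
    m · 1# + 1# + (- 1# + - (n · 1#))         ≈⟨ +-cong (+-comm _ _) (-‿+-comm _ _) ⟩
    1# + m · 1# + - (1# + n · 1#)             ≈⟨ +-cong (1+× m 1#) (-‿cong (1+× n 1#)) ⟨
    suc m · 1# + - (suc n · 1#)               ∎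

  fromℤ-neg : ∀ i → fromℤ (ℤ.- i) ≈ - fromℤ i
  fromℤ-neg (ℤ.+ zero)  = sym -0≈0
  fromℤ-neg (ℤ.+ suc n) = refl
  fromℤ-neg -[1+ n ]    = sym (-‿involutive _)

  fromℤ-+ : ∀ i j → fromℤ (i ℤ.+ j) ≈ fromℤ i + fromℤ j
  fromℤ-+ (ℤ.+ m)  (ℤ.+ n)  = ×-homo-+ 1# m n
  fromℤ-+ (ℤ.+ m)  -[1+ n ] = fromℤ-⊖ m (suc n)
  fromℤ-+ -[1+ m ] (ℤ.+ n)  = trans (fromℤ-⊖ n (suc m)) (+-comm _ _)
  fromℤ-+ -[1+ m ] -[1+ n ] = begin
    - (suc (suc (m ℕ.+ n)) · 1#)       ≡⟨ ≡.cong (λ k → - (k · 1#)) (≡.cong suc (≡.sym (ℕ.+-suc m n))) ⟩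
    - ((suc m ℕ.+ suc n) · 1#)         ≈⟨ -‿cong (×-homo-+ 1# (suc m) (suc n)) ⟩
    - (suc m · 1# + suc n · 1#)        ≈⟨ -‿+-comm _ _ ⟨
    - (suc m · 1#) + - (suc n · 1#)    ∎

  fromℤ-*⁺ : ∀ m j → fromℤ (ℤ.+ m ℤ.* j) ≈ m · 1# * fromℤ j
  fromℤ-*⁺ m (ℤ.+ n)  = begin
    fromℤ (ℤ.+ m ℤ.* ℤ.+ n)   ≡⟨ ≡.cong fromℤ (ℤ.pos-* m n) ⟨
    (m ℕ.* n) · 1#            ≈⟨ ×1-homo-* m n ⟩
    m · 1# * n · 1#           ∎
  fromℤ-*⁺ m -[1+ n ] = begin
    fromℤ (ℤ.+ m ℤ.* -[1+ n ])                 ≡⟨ ≡.cong fromℤ (ℤ.neg-distribʳ-* (ℤ.+ m) (ℤ.+ suc n)) ⟨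
    fromℤ (ℤ.- (ℤ.+ m ℤ.* ℤ.+ suc n))          ≈⟨ fromℤ-neg (ℤ.+ m ℤ.* ℤ.+ suc n) ⟩
    - fromℤ (ℤ.+ m ℤ.* ℤ.+ suc n)              ≈⟨ -‿cong (fromℤ-*⁺ m (ℤ.+ suc n)) ⟩
    - (m · 1# * suc n · 1#)                    ≈⟨ -‿distribʳ-* _ _ ⟩
    m · 1# * - (suc n · 1#)                    ∎

  fromℤ-* : ∀ i j → fromℤ (i ℤ.* j) ≈ fromℤ i * fromℤ j
  fromℤ-* (ℤ.+ m)  j = fromℤ-*⁺ m j
  fromℤ-* -[1+ m ] j = begin
    fromℤ (-[1+ m ] ℤ.* j)                 ≡⟨ ≡.cong fromℤ (ℤ.neg-distribˡ-* (ℤ.+ suc m) j) ⟨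
    fromℤ (ℤ.- (ℤ.+ suc m ℤ.* j))          ≈⟨ fromℤ-neg (ℤ.+ suc m ℤ.* j) ⟩
    - fromℤ (ℤ.+ suc m ℤ.* j)              ≈⟨ -‿cong (fromℤ-*⁺ (suc m) j) ⟩
    - (suc m · 1# * fromℤ j)               ≈⟨ -‿distribˡ-* _ _ ⟩
    - (suc m · 1#) * fromℤ j               ∎

  fromℤ-morphism : ℤ.+-*-rawRing -Raw-AlmostCommutative⟶ fromCommutativeRing K
  fromℤ-morphism = record
    { ⟦_⟧    = fromℤ
    ; +-homo = fromℤ-+
    ; *-homo = fromℤ-*
    ; -‿homo = fromℤ-neg
    ; 0-homo = refl
    ; 1-homo = refl
    }

  -- Distinct integers may have the same image in `K`, so a negative answer carries no information.
  _coeff≟_ : WeaklyDecidable (Induced-equivalence fromℤ-morphism)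
  i coeff≟ j with i ℤ.≟ j
  ... | yes i≡j = just (reflexive (≡.cong fromℤ i≡j))
  ... | no  _   = nothing

  open RingSolver ℤ.+-*-rawRing (fromCommutativeRing K) fromℤ-morphism _coeff≟_ public
    using (solve; _:=_; _:+_; _:*_; :-_; con)

-- Determinants

punchIn-cases : ∀ {n p} {P : Fin (suc n) → Set p} (j : Fin (suc n)) →
                P j → (∀ c → P (punchIn j c)) → ∀ w → P w
punchIn-cases {P = P} j Pj Pp w with j ≟ w
... | yes ≡.refl = Pj
... | no j≢w = ≡.subst P (Fin.punchIn-punchOut j≢w) (Pp (punchOut j≢w))

module Determinants (K : CommutativeRing 0ℓ 0ℓ) where
  open CommutativeRing K hiding (zero)
  open IntegerSolver K
  open Matrices (CommutativeRing.rawRing K) public using (Matrix; det; sign)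
  open Summation +-commutativeMonoid public using (sum; sum-cong-≋; sum-replicate-zero; ∑-distrib-+)
  open SemiringSummation semiring public using (*-distribˡ-sum; *-distribʳ-sum)
  open RingProperties ring using (x+x≈x⇒x≈0; -0#≈0#)
  open SetoidReasoning setoid

  infix 4 _≋_
  _≋_ : ∀ {n} → Vector Carrier n → Vector Carrier n → Set
  u ≋ v = ∀ c → u c ≈ v c

  ≡⇒≋ : ∀ {n} {u v : Vector Carrier n} → u ≡ v → u ≋ v
  ≡⇒≋ u≡v c = reflexive (≡.cong (λ w → w c) u≡v)

  ≋-refl : ∀ {n} {u : Vector Carrier n} → u ≋ u
  ≋-refl c = refl

  ≋-sym : ∀ {n} {u v : Vector Carrier n} → u ≋ v → v ≋ u
  ≋-sym u≋v c = sym (u≋v c)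

  ≋-trans : ∀ {n} {u v w : Vector Carrier n} → u ≋ v → v ≋ w → u ≋ w
  ≋-trans u≋v v≋w c = trans (u≋v c) (v≋w c)

  sum-zero : ∀ {n} (t : Vector Carrier n) → (∀ i → t i ≈ 0#) → sum t ≈ 0#
  sum-zero {n} t t≈0 = trans (sum-cong-≋ t≈0) (sum-replicate-zero n)

  sum-linear : ∀ {n} a (t t₁ t₂ : Vector Carrier n) → (∀ i → t i ≈ a * t₁ i + t₂ i) →
               sum t ≈ a * sum t₁ + sum t₂
  sum-linear a t t₁ t₂ eq = begin
    sum t                              ≈⟨ sum-cong-≋ eq ⟩
    sum (λ i → a * t₁ i + t₂ i)        ≈⟨ ∑-distrib-+ (λ i → a * t₁ i) t₂ ⟩
    sum (λ i → a * t₁ i) + sum t₂      ≈⟨ +-congʳ (*-distribˡ-sum a t₁) ⟨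
    a * sum t₁ + sum t₂                ∎

  unit : ∀ {n} → Matrix n
  unit j c = if does (j ≟ c) then 1# else 0#

  unit-diag : ∀ {n} (i : Fin n) → unit i i ≈ 1#
  unit-diag i = reflexive (≡.cong (λ b → if b then 1# else 0#) (dec-true (i ≟ i) ≡.refl))

  unit-off : ∀ {n} {i j : Fin n} → i ≢ j → unit i j ≈ 0#
  unit-off {i = i} {j} i≢j = reflexive (≡.cong (λ b → if b then 1# else 0#) (dec-false (i ≟ j) i≢j))

  sum-unit : ∀ {n} (x : Vector Carrier n) c → x c ≈ sum (λ j → x j * unit j c)
  sum-unit {suc n} x zero = sym (begin
    x zero * 1# + sum (λ j → x (suc j) * 0#)   ≈⟨ +-cong (*-identityʳ _) (sum-zero {n} _ (λ j → zeroʳ _)) ⟩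
    x zero + 0#                                ≈⟨ +-identityʳ _ ⟩
    x zero                                     ∎)
  sum-unit {suc n} x (suc c) = sym (begin
    x zero * 0# + sum (λ j → x (suc j) * unit j c)   ≈⟨ +-cong (zeroʳ _) (sym (sum-unit (x ∘ suc) c)) ⟩
    0# + x (suc c)                                   ≈⟨ +-identityˡ _ ⟩
    x (suc c)                                        ∎)

  -- Row-linearity is a relation between three matrices, so that it applies
  -- directly to forms that place their argument inside a larger matrix.
  record RowLinear {n} (f : Matrix n → Carrier) : Set where
    field
      cong   : ∀ {M N} → (∀ r → M r ≋ N r) → f M ≈ f N
      linear : ∀ i a {M M₁ M₂} → (∀ r → r ≢ i → M₁ r ≋ M r) → (∀ r → r ≢ i → M₂ r ≋ M r) →
               (∀ c → M i c ≈ a * M₁ i c + M₂ i c) → f M ≈ a * f M₁ + f M₂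

    linear-update : ∀ i a {M N} u → (∀ r → r ≢ i → N r ≋ M r) →
                    (∀ c → M i c ≈ a * N i c + u c) →
                    f M ≈ a * f N + f (updateAt M i (const u))
    linear-update i a {M} {N} u off eq = linear i a off
      (λ r r≢i → ≡⇒≋ (updateAt-minimal r i M r≢i))
      (λ c → trans (eq c) (+-congˡ (sym (≡⇒≋ (updateAt-updates i M) c))))

    -- A zero row is the sum of itself with itself, which makes `f M` its own double.
    zero-row : ∀ i {M} → (∀ c → M i c ≈ 0#) → f M ≈ 0#
    zero-row i {M} Mi≈0 = x+x≈x⇒x≈0 (f M) (sym (trans
      (linear i 1# (λ _ _ → ≋-refl) (λ _ _ → ≋-refl)
        (λ c → begin
          M i c                 ≈⟨ *-identityˡ _ ⟨
          1# * M i c            ≈⟨ +-identityʳ _ ⟨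
          1# * M i c + 0#       ≈⟨ +-congˡ (Mi≈0 c) ⟨
          1# * M i c + M i c    ∎))
      (+-congʳ (*-identityˡ _))))

    expand : ∀ i {m} (a : Vector Carrier m) (V : Fin m → Vector Carrier n) {M} →
             (∀ c → M i c ≈ sum (λ j → a j * V j c)) →
             f M ≈ sum (λ j → a j * f (updateAt M i (const (V j))))
    expand i {zero}  a V eq = zero-row i eq
    expand i {suc m} a V {M} eq = begin
      f M                                        ≈⟨ linear i (a zero) (off (V zero)) (off rest) split ⟩
      a zero * f (M₀) + f M′                     ≈⟨ +-congˡ (expand i (a ∘ suc) (V ∘ suc) (λ c → ≡⇒≋ (updateAt-updates i M) c)) ⟩
      a zero * f (M₀) + sum (λ j → a (suc j) * f (updateAt M′ i (const (V (suc j)))))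
                                                 ≈⟨ +-congˡ (sum-cong-≋ (λ j → *-congˡ (cong (twice (V (suc j)))))) ⟩
      a zero * f (M₀) + sum (λ j → a (suc j) * f (updateAt M i (const (V (suc j)))))
                                                 ∎
      where
      rest : Vector Carrier n
      rest c = sum (λ j → a (suc j) * V (suc j) c)
      M₀ M′ : Matrix n
      M₀ = updateAt M i (const (V zero))
      M′ = updateAt M i (const rest)
      off : ∀ u r → r ≢ i → updateAt M i (const u) r ≋ M r
      off u r r≢i = ≡⇒≋ (updateAt-minimal r i M r≢i)
      split : ∀ c → M i c ≈ a zero * M₀ i c + M′ i c
      split c = trans (eq c) (+-cong (*-congˡ (sym (≡⇒≋ (updateAt-updates i M) c)))
                                     (sym (≡⇒≋ (updateAt-updates i M) c)))
      twice : ∀ u r → updateAt M′ i (const u) r ≋ updateAt M i (const u) r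
      twice u r with r ≟ i
      ... | yes ≡.refl = ≡⇒≋ (≡.trans (updateAt-updates r M′) (≡.sym (updateAt-updates r M)))
      ... | no r≢i = ≡⇒≋ (≡.trans (updateAt-minimal r i M′ r≢i)
                            (≡.trans (updateAt-minimal r i M r≢i) (≡.sym (updateAt-minimal r i M r≢i))))

    -- Polarisation: `f` vanishes when the sum of the two rows stands in both positions, and
    -- additivity leaves only the two mixed terms. Vanishing is assumed for just this pair of rows,
    -- because `det-equal-to-first-row` exchanges rows before `det` is known to vanish on every
    -- pair.
    swap : ∀ {i j} → i ≢ j → (∀ M → M i ≋ M j → f M ≈ 0#) →
           ∀ {M N} → N i ≋ M j → N j ≋ M i → (∀ r → r ≢ i → r ≢ j → N r ≋ M r) →
           f M ≈ - f N
    swap {i} {j} i≢j alt {M} {N} Ni Nj Noff = begin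
      f M                                    ≈⟨ cong (λ r → ≋-sym (P-self r)) ⟩
      f (P u v)                              ≈⟨ solve 2 (λ x y → x := x :+ y :+ :- y) refl _ _ ⟩
      f (P u v) + f (P v u) + - f (P v u)    ≈⟨ +-congʳ vanish ⟩
      0# + - f (P v u)                       ≈⟨ +-identityˡ _ ⟩
      - f (P v u)                            ≈⟨ -‿cong (cong P-swapped) ⟩
      - f N                                  ∎
      where
      u v u+v : Vector Carrier n
      u = M i
      v = M j
      u+v c = u c + v c

      P : Vector Carrier n → Vector Carrier n → Matrix n
      P x y = updateAt (updateAt M i (const x)) j (const y)

      P-j : ∀ x y → P x y j ≡ y
      P-j x y = updateAt-updates j _

      P-i : ∀ x y → P x y i ≡ x
      P-i x y = ≡.trans (updateAt-minimal i j _ i≢j) (updateAt-updates i M)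

      P-off : ∀ x y {r} → r ≢ i → r ≢ j → P x y r ≡ M r
      P-off x y {r} r≢i r≢j = ≡.trans (updateAt-minimal r j _ r≢j) (updateAt-minimal r i M r≢i)

      P-self : ∀ r → P u v r ≋ M r
      P-self r with r ≟ i | r ≟ j
      ... | yes ≡.refl | _          = ≡⇒≋ (P-i u v)
      ... | no _       | yes ≡.refl = ≡⇒≋ (P-j u v)
      ... | no r≢i     | no r≢j     = ≡⇒≋ (P-off u v r≢i r≢j)

      P-swapped : ∀ r → P v u r ≋ N r
      P-swapped r with r ≟ i | r ≟ j
      ... | yes ≡.refl | _          = ≋-trans (≡⇒≋ (P-i v u)) (≋-sym Ni)
      ... | no _       | yes ≡.refl = ≋-trans (≡⇒≋ (P-j v u)) (≋-sym Nj)
      ... | no r≢i     | no r≢j     = ≋-trans (≡⇒≋ (P-off v u r≢i r≢j)) (≋-sym (Noff r r≢i r≢j))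

      P-offᵢ : ∀ x x′ y r → r ≢ i → P x y r ≋ P x′ y r
      P-offᵢ x x′ y r r≢i with r ≟ j
      ... | yes ≡.refl = ≡⇒≋ (≡.trans (P-j x y) (≡.sym (P-j x′ y)))
      ... | no r≢j = ≡⇒≋ (≡.trans (P-off x y r≢i r≢j) (≡.sym (P-off x′ y r≢i r≢j)))

      P-offⱼ : ∀ x y y′ r → r ≢ j → P x y r ≋ P x y′ r
      P-offⱼ x y y′ r r≢j = ≡⇒≋ (≡.trans (updateAt-minimal r j _ r≢j) (≡.sym (updateAt-minimal r j _ r≢j)))

      addᵢ : ∀ y → f (P u+v y) ≈ f (P u y) + f (P v y)
      addᵢ y = trans
        (linear i 1# (P-offᵢ u u+v y) (P-offᵢ v u+v y) (λ c → begin
          P u+v y i c                   ≈⟨ ≡⇒≋ (P-i u+v y) c ⟩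
          u c + v c                     ≈⟨ +-cong (≡⇒≋ (P-i u y) c) (≡⇒≋ (P-i v y) c) ⟨
          P u y i c + P v y i c         ≈⟨ +-congʳ (*-identityˡ _) ⟨
          1# * P u y i c + P v y i c    ∎))
        (+-congʳ (*-identityˡ _))

      addⱼ : ∀ x → f (P x u+v) ≈ f (P x u) + f (P x v)
      addⱼ x = trans
        (linear j 1# (P-offⱼ x u u+v) (P-offⱼ x v u+v) (λ c → begin
          P x u+v j c                   ≈⟨ ≡⇒≋ (P-j x u+v) c ⟩
          u c + v c                     ≈⟨ +-cong (≡⇒≋ (P-j x u) c) (≡⇒≋ (P-j x v) c) ⟨
          P x u j c + P x v j c         ≈⟨ +-congʳ (*-identityˡ _) ⟨
          1# * P x u j c + P x v j c    ∎))
        (+-congʳ (*-identityˡ _))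

      diagonal : ∀ x → f (P x x) ≈ 0#
      diagonal x = alt (P x x) (≡⇒≋ (≡.trans (P-i x x) (≡.sym (P-j x x))))

      vanish : f (P u v) + f (P v u) ≈ 0#
      vanish = begin
        f (P u v) + f (P v u)                             ≈⟨ +-cong (+-identityˡ _) (+-identityʳ _) ⟨
        (0# + f (P u v)) + (f (P v u) + 0#)               ≈⟨ +-cong (+-congʳ (diagonal u)) (+-congˡ (diagonal v)) ⟨
        (f (P u u) + f (P u v)) + (f (P v u) + f (P v v)) ≈⟨ +-cong (addⱼ u) (addⱼ v) ⟨
        f (P u u+v) + f (P v u+v)                         ≈⟨ addᵢ u+v ⟨
        f (P u+v u+v)                                     ≈⟨ diagonal u+v ⟩
        0#                                                ∎

  VanishesOnEqualRows : ∀ n → (Matrix n → Carrier) → Set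
  VanishesOnEqualRows n f = ∀ {i j : Fin n} → i ≢ j → ∀ M → M i ≋ M j → f M ≈ 0#

  record Alternating {n} (f : Matrix n → Carrier) : Set where
    field
      rowLinear   : RowLinear f
      alternating : VanishesOnEqualRows n f
    open RowLinear rowLinear public

  -- The Laplace expansion is alternating

  minor : ∀ {n} → Matrix (suc n) → Fin (suc n) → Matrix n
  minor M j r c = M (suc r) (punchIn j c)

  det-cong : ∀ {n} {M N : Matrix n} → (∀ r → M r ≋ N r) → det M ≈ det N
  det-cong {zero}  eq = refl
  det-cong {suc n} eq = sum-cong-≋ (λ j → *-congˡ {sign j}
    (*-cong (eq zero j) (det-cong (λ r c → eq (suc r) (punchIn j c)))))

  det-linear : ∀ {n} i a {M M₁ M₂ : Matrix n} →
               (∀ r → r ≢ i → M₁ r ≋ M r) → (∀ r → r ≢ i → M₂ r ≋ M r) →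
               (∀ c → M i c ≈ a * M₁ i c + M₂ i c) → det M ≈ a * det M₁ + det M₂
  det-linear {suc n} zero a {M} {M₁} {M₂} off₁ off₂ eq = sum-linear a _ _ _ (λ j → begin
    sign j * (M zero j * det (minor M j))
      ≈⟨ *-congˡ (*-congʳ (eq j)) ⟩
    sign j * ((a * M₁ zero j + M₂ zero j) * det (minor M j))
      ≈⟨ solve 5 (λ s a x y d → s :* ((a :* x :+ y) :* d) := a :* (s :* (x :* d)) :+ s :* (y :* d)) refl _ _ _ _ _ ⟩
    a * (sign j * (M₁ zero j * det (minor M j))) + sign j * (M₂ zero j * det (minor M j))
      ≈⟨ +-cong (*-congˡ (*-congˡ (*-congˡ (det-cong (λ r c → sym (off₁ (suc r) (λ ()) (punchIn j c)))))))
                (*-congˡ (*-congˡ (det-cong (λ r c → sym (off₂ (suc r) (λ ()) (punchIn j c)))))) ⟩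
    a * (sign j * (M₁ zero j * det (minor M₁ j))) + sign j * (M₂ zero j * det (minor M₂ j)) ∎)
  det-linear {suc n} (suc i) a {M} {M₁} {M₂} off₁ off₂ eq = sum-linear a _ _ _ (λ j → begin
    sign j * (M zero j * det (minor M j))
      ≈⟨ *-congˡ (*-congˡ (det-linear i a
           (λ r r≢i c → off₁ (suc r) (r≢i ∘ suc-injective) (punchIn j c))
           (λ r r≢i c → off₂ (suc r) (r≢i ∘ suc-injective) (punchIn j c))
           (λ c → eq (punchIn j c)))) ⟩
    sign j * (M zero j * (a * det (minor M₁ j) + det (minor M₂ j)))
      ≈⟨ solve 5 (λ s a x d e → s :* (x :* (a :* d :+ e)) := a :* (s :* (x :* d)) :+ s :* (x :* e)) refl _ _ _ _ _ ⟩
    a * (sign j * (M zero j * det (minor M₁ j))) + sign j * (M zero j * det (minor M₂ j))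
      ≈⟨ +-cong (*-congˡ (*-congˡ (*-congʳ (sym (off₁ zero (λ ()) j)))))
                (*-congˡ (*-congʳ (sym (off₂ zero (λ ()) j)))) ⟩
    a * (sign j * (M₁ zero j * det (minor M₁ j))) + sign j * (M₂ zero j * det (minor M₂ j)) ∎)

  det-rowLinear : ∀ {n} → RowLinear (det {n})
  det-rowLinear = record { cong = det-cong ; linear = det-linear }

  -- F is indexed by the ordered pairs (j , punchIn j c) of distinct indices;
  -- Skew says that exchanging the two indices changes the sign.
  Skew : ∀ m → (Fin (suc m) → Fin m → Carrier) → Set
  Skew zero    F = ⊤
  Skew (suc m) F = (∀ c → F zero c + F (suc c) zero ≈ 0#) ×
                   Skew m (λ j c → F (suc j) (suc c))

  Skew-cong : ∀ m {F G} → (∀ j c → F j c ≈ G j c) → Skew m F → Skew m G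
  Skew-cong zero    eq _        = tt
  Skew-cong (suc m) eq (s , s′) =
    (λ c → trans (+-cong (sym (eq zero c)) (sym (eq (suc c) zero))) (s c)) ,
    Skew-cong m (λ j c → eq (suc j) (suc c)) s′

  -- The pairs containing index 0 cancel two by two; the others form a sum of the same kind, one
  -- size smaller.
  Skew-sum : ∀ m F → Skew m F → sum (λ j → sum (F j)) ≈ 0#
  Skew-sum zero    F _        = +-identityʳ 0#
  Skew-sum (suc m) F (s , s′) = begin
    sum (F zero) + sum (λ j → F (suc j) zero + sum (λ c → F (suc j) (suc c)))
      ≈⟨ +-congˡ (∑-distrib-+ (λ j → F (suc j) zero) (λ j → sum (λ c → F (suc j) (suc c)))) ⟩
    sum (F zero) + (sum (λ j → F (suc j) zero) + sum (λ j → sum (λ c → F (suc j) (suc c))))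
      ≈⟨ +-congˡ (+-congˡ (Skew-sum m _ s′)) ⟩
    sum (F zero) + (sum (λ j → F (suc j) zero) + 0#)
      ≈⟨ +-congˡ (+-identityʳ _) ⟩
    sum (F zero) + sum (λ j → F (suc j) zero)
      ≈⟨ ∑-distrib-+ (F zero) (λ j → F (suc j) zero) ⟨
    sum (λ c → F zero c + F (suc c) zero)
      ≈⟨ sum-zero _ s ⟩
    0# ∎

  -- These are the terms of the expansion along two rows equal to `u`, with `g` the determinant of
  -- the remaining rows on the selected columns. The columns left over do not depend on the order in
  -- which two columns are removed, while the product of the signs does. Extensionality of `g` is
  -- assumed because the selecting maps sometimes agree only pointwise.
  expansion-Skew : ∀ m (u : Vector Carrier (2 ℕ.+ m)) (g : (Fin m → Fin (2 ℕ.+ m)) → Carrier) →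
    (∀ {h h′} → (∀ x → h x ≡ h′ x) → g h ≈ g h′) →
    Skew (suc m) (λ j c → sign j * sign c * (u j * u (punchIn j c)) * g (punchIn j ∘ punchIn c))
  expansion-Skew m u g g-ext = exchange , rest m u g g-ext
    where
    exchange : ∀ c → 1# * sign c * (u zero * u (suc c)) * g (suc ∘ punchIn c) +
                     (- sign c) * 1# * (u (suc c) * u zero) * g (punchIn (suc c) ∘ suc) ≈ 0#
    exchange c = solve 4 (λ s x y d →
        con ℤ.1ℤ :* s :* (x :* y) :* d :+ (:- s) :* con ℤ.1ℤ :* (y :* x) :* d := con ℤ.0ℤ)
      refl (sign c) (u zero) (u (suc c)) _

    rest : ∀ m (u : Vector Carrier (2 ℕ.+ m)) (g : (Fin m → Fin (2 ℕ.+ m)) → Carrier) →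
      (∀ {h h′} → (∀ x → h x ≡ h′ x) → g h ≈ g h′) →
      Skew m (λ j c → - sign j * sign {suc m} (suc c) *
                      (u (suc j) * u (suc (punchIn j c))) * g (punchIn (suc j) ∘ punchIn (suc c)))
    rest zero    u g g-ext = tt
    -- When neither removed column is column 0, that column survives, so the selection is `lift 1`
    -- of a smaller one. Both signs flip, which leaves their product unchanged.
    rest (suc m) u g g-ext = Skew-cong (suc m)
      (λ j c → begin
        sign j * sign c * (u (suc j) * u (suc (punchIn j c))) * g (lift 1 (punchIn j ∘ punchIn c))
          ≈⟨ *-congˡ (g-ext (λ { zero → ≡.refl ; (suc x) → ≡.refl })) ⟩
        sign j * sign c * (u (suc j) * u (suc (punchIn j c))) * g (punchIn (suc j) ∘ punchIn (suc c))
          ≈⟨ solve 4 (λ s t x d → s :* t :* x :* d := (:- s) :* (:- t) :* x :* d) refl _ _ _ _ ⟩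
        - sign j * - sign c * (u (suc j) * u (suc (punchIn j c))) * g (punchIn (suc j) ∘ punchIn (suc c)) ∎)
      (expansion-Skew m (u ∘ suc) (g ∘ lift 1)
        (λ eq → g-ext (λ { zero → ≡.refl ; (suc x) → ≡.cong suc (eq x) })))

  det-equal-first-rows : ∀ {n} (M : Matrix (2 ℕ.+ n)) → M zero ≋ M (suc zero) → det M ≈ 0#
  det-equal-first-rows {n} M eq = trans (sum-cong-≋ inner) (Skew-sum (suc n) F
      (expansion-Skew n (M zero) g (λ h≗h′ → det-cong (λ r c → reflexive (≡.cong (M (suc (suc r))) (h≗h′ c))))))
    where
    g : (Fin n → Fin (2 ℕ.+ n)) → Carrier
    g h = det (λ r c → M (suc (suc r)) (h c))

    F : Fin (2 ℕ.+ n) → Fin (1 ℕ.+ n) → Carrier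
    F j c = sign j * sign c * (M zero j * M zero (punchIn j c)) * g (punchIn j ∘ punchIn c)

    inner : ∀ j → sign j * (M zero j * sum (λ c → sign c * (M (suc zero) (punchIn j c) * g (punchIn j ∘ punchIn c)))) ≈
                  sum (F j)
    inner j = begin
      sign j * (M zero j * sum (λ c → sign c * (M (suc zero) (punchIn j c) * g (punchIn j ∘ punchIn c))))
        ≈⟨ *-assoc _ _ _ ⟨
      sign j * M zero j * sum (λ c → sign c * (M (suc zero) (punchIn j c) * g (punchIn j ∘ punchIn c)))
        ≈⟨ *-distribˡ-sum (sign j * M zero j) (λ c → sign c * (M (suc zero) (punchIn j c) * g (punchIn j ∘ punchIn c))) ⟩
      sum (λ c → sign j * M zero j * (sign c * (M (suc zero) (punchIn j c) * g (punchIn j ∘ punchIn c))))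
        ≈⟨ sum-cong-≋ (λ c → *-congˡ {sign j * M zero j} (*-congˡ {sign c} (*-congʳ {g (punchIn j ∘ punchIn c)} (sym (eq (punchIn j c)))))) ⟩
      sum (λ c → sign j * M zero j * (sign c * (M zero (punchIn j c) * g (punchIn j ∘ punchIn c))))
        ≈⟨ sum-cong-≋ (λ c → solve 5 (λ s t x y d → s :* x :* (t :* (y :* d)) := s :* t :* (x :* y) :* d)
                                     refl (sign j) (sign c) (M zero j) (M zero (punchIn j c)) (g (punchIn j ∘ punchIn c))) ⟩
      sum (F j) ∎

  det-equal-later-rows : ∀ {n} → VanishesOnEqualRows n det →
                         ∀ {i j : Fin n} → i ≢ j → ∀ M → M (suc i) ≋ M (suc j) → det M ≈ 0#
  det-equal-later-rows alt i≢j M eq = sum-zero _ (λ k → begin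
    sign k * (M zero k * det (minor M k))
      ≈⟨ *-congˡ (*-congˡ (alt i≢j (minor M k) (λ c → eq (punchIn k c)))) ⟩
    sign k * (M zero k * 0#)   ≈⟨ *-congˡ (zeroʳ _) ⟩
    sign k * 0#                ≈⟨ zeroʳ _ ⟩
    0#                         ∎)

  -- Exchanging row `suc j` with row 1, which alternation of the minors permits, reduces the claim
  -- to two equal rows at the top.
  det-equal-to-first-row : ∀ {n} → VanishesOnEqualRows n det →
                           ∀ (j : Fin n) M → M zero ≋ M (suc j) → det M ≈ 0#
  det-equal-to-first-row alt zero    M eq = det-equal-first-rows M eq
  det-equal-to-first-row alt (suc j) M eq = begin
    det M        ≈⟨ RowLinear.swap det-rowLinear {suc zero} {suc (suc j)} (λ ())
                      (det-equal-later-rows alt (λ ())) {M} {N}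
                      ≋-refl (≡⇒≋ (updateAt-updates (suc j) {const (M (suc zero))} (N₁ ∘ suc)))
                      (λ r r≢1 r≢2+j → ≡⇒≋ (≡.trans (updateAt-minimal r (suc (suc j)) N₁ r≢2+j)
                                                     (updateAt-minimal r (suc zero) M r≢1))) ⟩
    - det N      ≈⟨ -‿cong (det-equal-first-rows N eq) ⟩
    - 0#         ≈⟨ -0#≈0# ⟩
    0#           ∎
    where
    N₁ N : Matrix _
    N₁ = updateAt M (suc zero) (const (M (suc (suc j))))
    N = updateAt N₁ (suc (suc j)) (const (M (suc zero)))

  det-alternating : ∀ n → VanishesOnEqualRows n det
  det-alternating (suc n) {zero}  {zero}  i≢j M eq = contradiction ≡.refl i≢j
  det-alternating (suc n) {zero}  {suc j} i≢j M eq =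
    det-equal-to-first-row (det-alternating n) j M eq
  det-alternating (suc n) {suc i} {zero}  i≢j M eq =
    det-equal-to-first-row (det-alternating n) i M (≋-sym eq)
  det-alternating (suc n) {suc i} {suc j} i≢j M eq =
    det-equal-later-rows (det-alternating n) (i≢j ∘ ≡.cong suc) M eq

  det-isAlternating : ∀ {n} → Alternating (det {n})
  det-isAlternating = record { rowLinear = det-rowLinear ; alternating = det-alternating _ }

  det-unit : ∀ n → det (unit {n}) ≈ 1#
  det-unit zero    = refl
  det-unit (suc n) = begin
    1# * (1# * det (unit {n})) + sum {n} (λ j → - sign j * (0# * det (minor unit (suc j))))
      ≈⟨ +-cong (trans (*-identityˡ _) (*-identityˡ _)) (sum-zero {n} (λ j → - sign j * (0# * det (minor unit (suc j))))
                  (λ j → trans (*-congˡ (zeroˡ _)) (zeroʳ _))) ⟩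
    det (unit {n}) + 0#   ≈⟨ +-identityʳ _ ⟩
    det (unit {n})        ≈⟨ det-unit n ⟩
    1#                    ∎

  -- Uniqueness of alternating forms

  toggle-all : ∀ n (g : Vec Bool n → Carrier) → (∀ S t → g S ≈ g (S [ t ]≔ true)) →
               g (Vec.replicate n false) ≈ g (Vec.replicate n true)
  toggle-all zero    g step = refl
  toggle-all (suc n) g step =
    trans (toggle-all n (λ S → g (false Vec.∷ S)) (λ S t → step (false Vec.∷ S) (suc t)))
          (step (false Vec.∷ Vec.replicate n true) zero)

  module _ {n} {f : Matrix n → Carrier} (form : Alternating f) where
    open Alternating form

    -- By linearity the two values differ by the value with `d`, the difference of the rows, in row
    -- `r`. After expanding `d` in unit vectors, each term has coefficient zero or repeats a unit
    -- vector that is already another row.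
    clear-row : ∀ r {M N} → (∀ s → s ≢ r → M s ≋ N s) →
                (∀ c → M r c ≈ N r c ⊎ ∃[ s ] s ≢ r × M s ≋ unit c) → f M ≈ f N
    clear-row r {M} {N} off clearable = begin
      f M             ≈⟨ linear-update r 1# d (λ s s≢r → ≋-sym (off s s≢r)) (λ c →
                           solve 2 (λ x y → x := con ℤ.1ℤ :* y :+ (x :+ :- y)) refl (M r c) (N r c)) ⟩
      1# * f N + f D  ≈⟨ +-cong (*-identityˡ _) D-zero ⟩
      f N + 0#        ≈⟨ +-identityʳ _ ⟩
      f N             ∎
      where
      d : Vector Carrier n
      d c = M r c + - N r c

      D : Matrix n
      D = updateAt M r (const d)

      term-zero : ∀ c → d c * f (updateAt D r (const (unit c))) ≈ 0#
      term-zero c with clearable c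
      ... | inj₁ eq = trans (*-congʳ (trans (+-congʳ eq) (-‿inverseʳ _))) (zeroˡ _)
      ... | inj₂ (s , s≢r , Ms) = trans (*-congˡ (alternating s≢r _
              (≋-trans (≡⇒≋ (≡.trans (updateAt-minimal s r D s≢r) (updateAt-minimal s r M s≢r)))
              (≋-trans Ms (≡⇒≋ (≡.sym (updateAt-updates r D))))))) (zeroʳ _)

      D-zero : f D ≈ 0#
      D-zero = trans
        (expand r d unit (λ c → trans (≡⇒≋ (updateAt-updates r M) c) (sum-unit d c)))
        (sum-zero _ term-zero)

    -- Rows of `M` are replaced by rows of `N` one at a time. In the intermediate matrices row `s`
    -- may come from either side, which is why it has to be the unit vector in both.
    clear : ∀ {M N} →
            (∀ r c → M r c ≈ N r c ⊎ ∃[ s ] s ≢ r × M s ≋ unit c × N s ≋ unit c) →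
            f M ≈ f N
    clear {M} {N} clearable = begin
      f M                             ≈⟨ cong (λ r → ≡⇒≋ (≡.sym (≡.cong (λ b → if b then N r else M r) (Vec.lookup-replicate r false)))) ⟩
      f (H (Vec.replicate n false))   ≈⟨ toggle-all n (f ∘ H) step ⟩
      f (H (Vec.replicate n true))    ≈⟨ cong (λ r → ≡⇒≋ (≡.cong (λ b → if b then N r else M r) (Vec.lookup-replicate r true))) ⟩
      f N                             ∎
      where
      H : Vec Bool n → Matrix n
      H S r = if lookup S r then N r else M r

      both : ∀ S {s c} → M s ≋ unit c → N s ≋ unit c → H S s ≋ unit c
      both S {s} Ms Ns with lookup S s
      ... | true  = Ns
      ... | false = Ms

      step : ∀ S t → f (H S) ≈ f (H (S [ t ]≔ true))
      step S t = clear-row t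
        (λ s s≢t → ≡⇒≋ (≡.cong (λ b → if b then N s else M s) (≡.sym (Vec.lookup∘update′ s≢t S true))))
        entry
        where
        new : H (S [ t ]≔ true) t ≋ N t
        new = ≡⇒≋ (≡.cong (λ b → if b then N t else M t) (Vec.lookup∘update t S true))

        entry : ∀ c → H S t c ≈ H (S [ t ]≔ true) t c ⊎ ∃[ s ] s ≢ t × H S s ≋ unit c
        entry c with lookup S t | clearable t c
        ... | true  | _                         = inj₁ (sym (new c))
        ... | false | inj₁ eq                   = inj₁ (trans eq (sym (new c)))
        ... | false | inj₂ (s , s≢t , Ms , Ns)  = inj₂ (s , s≢t , both S {s} {c} Ms Ns)

  sign-inject₁ : ∀ {n} (j : Fin n) → sign (inject₁ j) ≡ sign j
  sign-inject₁ zero    = ≡.refl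
  sign-inject₁ (suc j) = ≡.cong -_ (sign-inject₁ j)

  punchIn-inject₁ : ∀ {n} (j : Fin n) → punchIn (inject₁ j) j ≡ suc j
  punchIn-inject₁ zero    = ≡.refl
  punchIn-inject₁ (suc j) = ≡.cong suc (punchIn-inject₁ j)

  punchIn-suc : ∀ {n} (j : Fin n) → punchIn (suc j) j ≡ inject₁ j
  punchIn-suc zero    = ≡.refl
  punchIn-suc (suc j) = ≡.cong suc (punchIn-suc j)

  punchIn-inject₁-off : ∀ {n} (j : Fin n) r → r ≢ j → punchIn (inject₁ j) r ≡ punchIn (suc j) r
  punchIn-inject₁-off zero    zero    r≢j = contradiction ≡.refl r≢j
  punchIn-inject₁-off zero    (suc r) r≢j = ≡.refl
  punchIn-inject₁-off (suc j) zero    r≢j = ≡.refl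
  punchIn-inject₁-off (suc j) (suc r) r≢j = ≡.cong suc (punchIn-inject₁-off j r (r≢j ∘ ≡.cong suc))

  toFront : ∀ {n} → Fin (suc n) → Fin (suc n) → Fin (suc n)
  toFront j zero    = j
  toFront j (suc r) = punchIn j r

  -- The arrangements for `inject₁ j` and `suc j` differ by exchanging row 0 with row `suc j`, so
  -- each increment of the index contributes one sign change.
  form-toFront : ∀ {n} {f : Matrix (suc n) → Carrier} → Alternating f →
                 ∀ j → f (unit ∘ toFront j) ≈ sign j * f unit
  form-toFront {n} {f} form = <-weakInduction _ base step
    where
    open Alternating form
    base : f (unit ∘ toFront zero) ≈ 1# * f unit
    base = trans (cong (λ { zero → ≋-refl ; (suc r) → ≋-refl })) (sym (*-identityˡ _))
    step : ∀ (j : Fin n) → f (unit ∘ toFront (inject₁ j)) ≈ sign (inject₁ j) * f unit →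
           f (unit ∘ toFront (suc j)) ≈ - sign j * f unit
    step j ih = begin
      f (unit ∘ toFront (suc j))            ≈⟨ swap (λ ()) (alternating (λ ()))
                                                 (≡⇒≋ (≡.cong unit (≡.sym (punchIn-suc j))))
                                                 (≡⇒≋ (≡.cong unit (punchIn-inject₁ j))) others ⟩
      - f (unit ∘ toFront (inject₁ j))      ≈⟨ -‿cong ih ⟩
      - (sign (inject₁ j) * f unit)         ≡⟨ ≡.cong (λ s → - (s * f unit)) (sign-inject₁ j) ⟩
      - (sign j * f unit)                   ≈⟨ solve 2 (λ s x → :- (s :* x) := (:- s) :* x) refl _ _ ⟩
      - sign j * f unit                     ∎
      where
      others : ∀ r → r ≢ zero → r ≢ suc j → unit (toFront (inject₁ j) r) ≋ unit (toFront (suc j) r)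
      others zero    r≢0 _     = contradiction ≡.refl r≢0
      others (suc r) _   r≢j+1 = ≡⇒≋ (≡.cong unit (punchIn-inject₁-off j r (r≢j+1 ∘ ≡.cong suc)))

  bordered : ∀ {n} → Fin (suc n) → Matrix n → Matrix (suc n)
  bordered j N zero    = unit j
  bordered j N (suc r) = insertAt (N r) j 0#

  insertAt-linear : ∀ {n} a {u v w : Vector Carrier n} j → (∀ c → u c ≈ a * v c + w c) →
                    ∀ c → insertAt u j 0# c ≈ a * insertAt v j 0# c + insertAt w j 0# c
  insertAt-linear a {u} {v} {w} j eq = punchIn-cases j
    (begin
      insertAt u j 0# j                            ≡⟨ insertAt-lookup u j 0# ⟩
      0#                                           ≈⟨ solve 1 (λ a → con ℤ.0ℤ := a :* con ℤ.0ℤ :+ con ℤ.0ℤ) refl a ⟩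
      a * 0# + 0#                                  ≡⟨ ≡.cong₂ (λ x y → a * x + y) (insertAt-lookup v j 0#) (insertAt-lookup w j 0#) ⟨
      a * insertAt v j 0# j + insertAt w j 0# j    ∎)
    (λ c → begin
      insertAt u j 0# (punchIn j c)                ≡⟨ insertAt-punchIn u j 0# c ⟩
      u c                                          ≈⟨ eq c ⟩
      a * v c + w c                                ≡⟨ ≡.cong₂ (λ x y → a * x + y) (insertAt-punchIn v j 0# c) (insertAt-punchIn w j 0# c) ⟨
      a * insertAt v j 0# (punchIn j c) + insertAt w j 0# (punchIn j c) ∎)

  insertAt-cong : ∀ {n} {u v : Vector Carrier n} j → u ≋ v → insertAt u j 0# ≋ insertAt v j 0#
  insertAt-cong {u = u} {v} j eq = punchIn-cases j
    (reflexive (≡.trans (insertAt-lookup u j 0#) (≡.sym (insertAt-lookup v j 0#))))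
    (λ c → trans (reflexive (insertAt-punchIn u j 0# c))
                 (trans (eq c) (reflexive (≡.sym (insertAt-punchIn v j 0# c)))))

  insertAt-unit : ∀ {n} j (r : Fin n) → insertAt (unit r) j 0# ≋ unit (punchIn j r)
  insertAt-unit j r = punchIn-cases j
    (trans (reflexive (insertAt-lookup (unit r) j 0#)) (sym (unit-off (Fin.punchInᵢ≢i j r))))
    (λ c → trans (reflexive (insertAt-punchIn (unit r) j 0# c)) (entry c))
    where
    entry : ∀ c → unit r c ≈ unit (punchIn j r) (punchIn j c)
    entry c with r ≟ c
    ... | yes ≡.refl = sym (unit-diag (punchIn j c))
    ... | no r≢c = sym (unit-off (r≢c ∘ Fin.punchIn-injective j r c))

  -- The added row is constant and the inserted column is zero, so every later row depends linearly
  -- on one row of the smaller matrix.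
  bordered-alternating : ∀ {n} {f : Matrix (suc n) → Carrier} → Alternating f →
                         ∀ j → Alternating (f ∘ bordered j)
  bordered-alternating {n} {f} form j = record
    { rowLinear = record
      { cong = λ eq → cong (λ { zero → ≋-refl ; (suc r) → insertAt-cong j (eq r) })
      ; linear = λ i a off₁ off₂ eq → linear (suc i) a
          (λ { zero _ → ≋-refl ; (suc r) r≢i → insertAt-cong j (off₁ r (r≢i ∘ ≡.cong suc)) })
          (λ { zero _ → ≋-refl ; (suc r) r≢i → insertAt-cong j (off₂ r (r≢i ∘ ≡.cong suc)) })
          (insertAt-linear a j eq)
      }
    ; alternating = λ i≢j N eq → alternating (i≢j ∘ suc-injective) (bordered j N) (insertAt-cong j eq)
    }
    where open Alternating form

  -- Expanding row 0 in unit vectors leaves, for each `j`, an alternating form of the minor, to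
  -- which induction applies. Its value at the unit minor is `f` on a cyclic rearrangement of the
  -- unit rows, and this produces the sign of the Laplace expansion.
  form-unique : ∀ {n} {f : Matrix n → Carrier} → Alternating f → ∀ M → f M ≈ det M * f unit
  form-unique {zero}  form M = trans (Alternating.cong form (λ ())) (sym (*-identityˡ _))
  form-unique {suc n} {f} form M = begin
    f M
      ≈⟨ expand zero (M zero) unit (sum-unit (M zero)) ⟩
    sum (λ j → M zero j * f (updateAt M zero (const (unit j))))
      ≈⟨ sum-cong-≋ (λ j → *-congˡ {M zero j} (along j)) ⟩
    sum (λ j → M zero j * (det (minor M j) * (sign j * f unit)))
      ≈⟨ sum-cong-≋ (λ j → solve 4 (λ x d s e → x :* (d :* (s :* e)) := s :* (x :* d) :* e) refl
                             (M zero j) (det (minor M j)) (sign j) (f unit)) ⟩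
    sum (λ j → sign j * (M zero j * det (minor M j)) * f unit)
      ≈⟨ *-distribʳ-sum (f unit) (λ j → sign j * (M zero j * det (minor M j))) ⟨
    det M * f unit ∎
    where
    open Alternating form
    along : ∀ j → f (updateAt M zero (const (unit j))) ≈ det (minor M j) * (sign j * f unit)
    along j = begin
      f (updateAt M zero (const (unit j)))      ≈⟨ clear form entry ⟩
      f (bordered j (minor M j))                ≈⟨ form-unique (bordered-alternating form j) (minor M j) ⟩
      det (minor M j) * f (bordered j unit)     ≈⟨ *-congˡ (cong (λ { zero → ≋-refl ; (suc r) → insertAt-unit j r })) ⟩
      det (minor M j) * f (unit ∘ toFront j)    ≈⟨ *-congˡ (form-toFront form j) ⟩
      det (minor M j) * (sign j * f unit)       ∎
      where
      M′ N′ : Matrix (suc n)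
      M′ = updateAt M zero (const (unit j))
      N′ = bordered j (minor M j)
      entry : ∀ r c → M′ r c ≈ N′ r c ⊎ ∃[ s ] s ≢ r × M′ s ≋ unit c × N′ s ≋ unit c
      entry zero    c = inj₁ refl
      entry (suc r) = punchIn-cases j
        -- Row 0 is now `unit j`, so it clears column `j` in all rows below.
        (inj₂ (zero , (λ ()) , ≋-refl , ≋-refl))
        (λ c → inj₁ (reflexive (≡.sym (insertAt-punchIn (minor M j r) j 0# c))))

  -- A diagonal block carried by an injection

  module _ {m n} (e : Fin m → Fin n) (e-injective : Injective _≡_ _≡_ e) where

    inImage? : ∀ v → Dec (∃[ a ] e a ≡ v)
    inImage? v = Fin.any? (λ a → e a ≟ v)

    withUnitRows : Matrix n → Matrix n
    withUnitRows M v = if does (inImage? v) then unit v else M v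

    extend : Vector Carrier m → Vector Carrier n
    extend u w with inImage? w
    ... | yes (b , _) = u b
    ... | no  _       = 0#

    -- Keeping `M` fixed and letting `B` vary gives a form on the small matrices, so `form-unique`
    -- can be applied to a block without reordering rows or columns.
    place : Matrix n → Matrix m → Matrix n
    place M B v with inImage? v
    ... | yes (a , _) = extend (B a)
    ... | no  _       = M v

    extend-cong : ∀ {u v} → u ≋ v → extend u ≋ extend v
    extend-cong eq w with inImage? w
    ... | yes (b , _) = eq b
    ... | no  _       = refl

    extend-linear : ∀ a {u v w} → (∀ c → u c ≈ a * v c + w c) →
                    ∀ c → extend u c ≈ a * extend v c + extend w c
    extend-linear a eq c with inImage? c
    ... | yes (b , _) = eq b
    ... | no  _       = solve 1 (λ a → con ℤ.0ℤ := a :* con ℤ.0ℤ :+ con ℤ.0ℤ) refl a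

    place-image : ∀ M B a → place M B (e a) ≡ extend (B a)
    place-image M B a with inImage? (e a)
    ... | yes (a′ , eq) = ≡.cong (extend ∘ B) (e-injective eq)
    ... | no  ¬a        = contradiction (a , ≡.refl) ¬a

    place-agree : ∀ M {B C} v → (∀ a → e a ≡ v → B a ≋ C a) → place M B v ≋ place M C v
    place-agree M v eq with inImage? v
    ... | yes (a , ea≡v) = extend-cong (eq a ea≡v)
    ... | no  _          = ≋-refl

    place-alternating : ∀ M → Alternating (det ∘ place M)
    place-alternating M = record
      { rowLinear = record
        { cong = λ eq → det-cong (λ v → place-agree M v (λ a _ → eq a))
        ; linear = λ i a {B} {B₁} {B₂} off₁ off₂ eq → det-linear (e i) a
            (λ v v≢ei → place-agree M v (λ b eb≡v → off₁ b (λ b≡i → v≢ei (≡.trans (≡.sym eb≡v) (≡.cong e b≡i)))))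
            (λ v v≢ei → place-agree M v (λ b eb≡v → off₂ b (λ b≡i → v≢ei (≡.trans (≡.sym eb≡v) (≡.cong e b≡i)))))
            (λ c → begin
              place M B (e i) c                        ≈⟨ ≡⇒≋ (place-image M B i) c ⟩
              extend (B i) c                           ≈⟨ extend-linear a eq c ⟩
              a * extend (B₁ i) c + extend (B₂ i) c    ≈⟨ +-cong (*-congˡ (≡⇒≋ (place-image M B₁ i) c)) (≡⇒≋ (place-image M B₂ i) c) ⟨
              a * place M B₁ (e i) c + place M B₂ (e i) c ∎)
        }
      ; alternating = λ {i} {j} i≢j B eq → det-alternating _ (i≢j ∘ e-injective) (place M B)
          (≋-trans (≡⇒≋ (place-image M B i))
          (≋-trans (extend-cong eq) (≡⇒≋ (≡.sym (place-image M B j)))))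
      }

    -- Since the rows through `e` vanish off the block, `M` is recovered by placing its own block
    -- into itself. Its determinant is then `det block` times the value at the unit block, where
    -- those rows become unit rows of the large matrix.
    det-block : ∀ M → (∀ a w → ¬ (∃[ b ] e b ≡ w) → M (e a) w ≈ 0#) →
                det M ≈ det (λ a b → M (e a) (e b)) * det (withUnitRows M)
    det-block M vanish = begin
      det M                                    ≈⟨ det-cong whole ⟩
      det (place M block)                      ≈⟨ form-unique (place-alternating M) block ⟩
      det block * det (place M unit)           ≈⟨ *-congˡ (det-cong units) ⟩
      det block * det (withUnitRows M)         ∎
      where
      block : Matrix m
      block a b = M (e a) (e b)

      whole : ∀ v → M v ≋ place M block v
      whole v w with inImage? v
      ... | no _ = refl
      ... | yes (a , ≡.refl) with inImage? w
      ...   | yes (b , ≡.refl) = refl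
      ...   | no ¬b = vanish a w ¬b

      units : ∀ v → place M unit v ≋ withUnitRows M v
      units v w with inImage? v
      ... | no _ = refl
      ... | yes (a , ≡.refl) with inImage? w
      ...   | no ¬b = sym (unit-off (λ ea≡w → ¬b (a , ea≡w)))
      ...   | yes (b , ≡.refl) with a ≟ b
      ...     | yes ≡.refl = sym (unit-diag (e b))
      ...     | no a≢b = sym (unit-off (a≢b ∘ e-injective))

-- Block triangular matrices

x∉p-x : ∀ {n} (p : Subset n) x → x ∉ p Subset.- x
x∉p-x p x x∈p-x = Subset.⊂-irref (Subset.p─q─q≡p─q p Subset.⁅ x ⁆) (Subset.x∈p⇒p-x⊂p x∈p-x)

module _ {k} {_≺_ : Rel (Fin k) 0ℓ} (isSPO : IsStrictPartialOrder _≡_ _≺_)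
         (_≺?_ : Decidable _≺_) where

  minimal-element : ∀ (U : Subset k) → Nonempty U → ∃[ T ] T ∈ U × (∀ {j} → j ∈ U → ¬ j ≺ T)
  minimal-element U (T , T∈U) = descend T∈U (spo-wellFounded isSPO T)
    where
    descend : ∀ {T} → T ∈ U → Acc _≺_ T → ∃[ T ] T ∈ U × (∀ {j} → j ∈ U → ¬ j ≺ T)
    descend {T} T∈U (acc rec) with Fin.any? (λ j → (j ∈? U) ×-dec (j ≺? T))
    ... | yes (j , j∈U , j≺T) = descend j∈U (rec j≺T)
    ... | no none             = T , T∈U , λ {j} j∈U j≺T → none (j , j∈U , j≺T)

module BlockTriangular (K : CommutativeRing 0ℓ 0ℓ) where
  open CommutativeRing K hiding (zero)
  open Determinants K
  open Summation *-commutativeMonoid public using () renaming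
    (sum to product; sum-cong-≋ to product-cong; sum-remove to product-remove; sum-replicate-zero to product-replicate-one)
  open SetoidReasoning setoid

  product-extract : ∀ {k} (T : Fin k) {f g : Vector Carrier k} → g T ≈ 1# →
                    (∀ i → i ≢ T → f i ≈ g i) → product f ≈ f T * product g
  product-extract {suc k} T {f} {g} gT≈1 off = begin
    product f                                  ≈⟨ product-remove {i = T} f ⟩
    f T * product (f ∘ punchIn T)              ≈⟨ *-congˡ (product-cong (λ i → off (punchIn T i) (Fin.punchInᵢ≢i T i))) ⟩
    f T * product (g ∘ punchIn T)              ≈⟨ *-congˡ (*-identityˡ _) ⟨
    f T * (1# * product (g ∘ punchIn T))       ≈⟨ *-congˡ (*-congʳ gT≈1) ⟨
    f T * (g T * product (g ∘ punchIn T))      ≈⟨ *-congˡ (product-remove {i = T} g) ⟨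
    f T * product g                            ∎

  module _ {n k} (comp : Fin n → Fin k) {size : Fin k → ℕ} (e : ∀ i → Fin (size i) → Fin n)
           (e-injective : ∀ i → Injective _≡_ _≡_ (e i)) (comp-e : ∀ i a → comp (e i a) ≡ i)
           (e-surjective : ∀ v → ∃[ a ] e (comp v) a ≡ v)
           {_≺_ : Rel (Fin k) 0ℓ} (isSPO : IsStrictPartialOrder _≡_ _≺_) (_≺?_ : Decidable _≺_)
           (M : Matrix n) (triangular : ∀ v w → comp v ≢ comp w → ¬ comp w ≺ comp v → M v w ≈ 0#)
           where

    block : ∀ i → Matrix (size i)
    block i a b = M (e i a) (e i b)

    -- Blocks outside `U` become identity blocks instead of being deleted, so the matrix keeps its
    -- size and no reindexing arises as blocks are split off.
    restrict : Subset k → Matrix n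
    restrict U v w = if does (comp v ∈? U ×-dec comp w ∈? U) then M v w else unit v w

    restrict-inside : ∀ U {v w} → comp v ∈ U → comp w ∈ U → restrict U v w ≡ M v w
    restrict-inside U {v} {w} v∈U w∈U =
      ≡.cong (λ b → if b then M v w else unit v w) (dec-true (comp v ∈? U ×-dec comp w ∈? U) (v∈U , w∈U))

    restrict-outside : ∀ U {v w} → ¬ (comp v ∈ U × comp w ∈ U) → restrict U v w ≡ unit v w
    restrict-outside U {v} {w} outside =
      ≡.cong (λ b → if b then M v w else unit v w) (dec-false (comp v ∈? U ×-dec comp w ∈? U) outside)

    factors : Subset k → Vector Carrier k
    factors U i = if does (i ∈? U) then det (block i) else 1#

    factors-inside : ∀ U {i} → i ∈ U → factors U i ≡ det (block i)
    factors-inside U {i} i∈U = ≡.cong (λ b → if b then det (block i) else 1#) (dec-true (i ∈? U) i∈U)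

    factors-outside : ∀ U {i} → i ∉ U → factors U i ≡ 1#
    factors-outside U {i} i∉U = ≡.cong (λ b → if b then det (block i) else 1#) (dec-false (i ∈? U) i∉U)

    inBlock : ∀ {i v} → comp v ≡ i → ∃[ a ] e i a ≡ v
    inBlock ≡.refl = e-surjective _

    -- Minimality of `T` makes the rows of its block vanish in the columns of all other blocks of
    -- `U`, so `det-block` applies. The unit rows it leaves behind then clear the columns of the
    -- block in the remaining rows.
    remove-minimal : ∀ U {T} → T ∈ U → (∀ {j} → j ∈ U → ¬ j ≺ T) →
                     det (restrict U) ≈ det (block T) * det (restrict (U Subset.- T))
    remove-minimal U {T} T∈U minimal = begin
      det (restrict U)
        ≈⟨ det-block (e T) (e-injective T) (restrict U) vanish ⟩
      det (λ a b → restrict U (e T a) (e T b)) * det X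
        ≈⟨ *-cong (det-cong (λ a b → reflexive (restrict-inside U (e∈U a) (e∈U b))))
                  (clear det-isAlternating entry) ⟩
      det (block T) * det (restrict U′) ∎
      where
      U′ : Subset k
      U′ = U Subset.- T

      X : Matrix n
      X = withUnitRows (e T) (e-injective T) (restrict U)

      e∈U : ∀ a → comp (e T a) ∈ U
      e∈U a = ≡.subst (_∈ U) (≡.sym (comp-e T a)) T∈U

      vanish : ∀ a w → ¬ (∃[ b ] e T b ≡ w) → restrict U (e T a) w ≈ 0#
      vanish a w w∉ = case comp w ∈? U of λ where
        (no w∉U) → trans (reflexive (restrict-outside U (w∉U ∘ proj₂))) (unit-off (λ ea≡w → w∉ (a , ea≡w)))
        (yes w∈U) → trans (reflexive (restrict-inside U (e∈U a) w∈U)) (triangular (e T a) w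
            (λ eq → w∉ (inBlock (≡.trans (≡.sym eq) (comp-e T a))))
            (≡.subst (λ i → ¬ comp w ≺ i) (≡.sym (comp-e T a)) (minimal w∈U)))

      T∉U′ : T ∉ U′
      T∉U′ = x∉p-x U T

      image∉U′ : ∀ a → comp (e T a) ∉ U′
      image∉U′ a = T∉U′ ∘ ≡.subst (_∈ U′) (comp-e T a)

      notT : ∀ {v} → ¬ (∃[ a ] e T a ≡ v) → comp v ≢ T
      notT v∉ eq = v∉ (inBlock eq)

      outside⇒same : ∀ {v w} → comp v ≢ T → comp w ≢ T → restrict U v w ≡ restrict U′ v w
      outside⇒same {v} {w} v≢T w≢T = case comp v ∈? U ×-dec comp w ∈? U of λ where
        (yes (v∈U , w∈U)) → ≡.trans (restrict-inside U v∈U w∈U) (≡.sym (restrict-inside U′ (Subset.x∈p∧x≢y⇒x∈p-y v∈U v≢T) (Subset.x∈p∧x≢y⇒x∈p-y w∈U w≢T)))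
        (no outside) → ≡.trans (restrict-outside U outside) (≡.sym (restrict-outside U′
          (λ (v∈U′ , w∈U′) → outside (Subset.p─q⊆p _ _ v∈U′ , Subset.p─q⊆p _ _ w∈U′))))

      X-image : ∀ {v} → ∃[ a ] e T a ≡ v → X v ≡ unit v
      X-image {v} v∈ = ≡.cong (λ b → if b then unit v else restrict U v) (dec-true (inImage? (e T) (e-injective T) v) v∈)

      X-off : ∀ {v} → ¬ (∃[ a ] e T a ≡ v) → X v ≡ restrict U v
      X-off {v} v∉ = ≡.cong (λ b → if b then unit v else restrict U v) (dec-false (inImage? (e T) (e-injective T) v) v∉)

      restrict-image : ∀ {v} → ∃[ a ] e T a ≡ v → restrict U′ v ≋ unit v
      restrict-image (a , ≡.refl) c = reflexive (restrict-outside U′ (image∉U′ a ∘ proj₁))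

      entry : ∀ v w → X v w ≈ restrict U′ v w ⊎ ∃[ s ] s ≢ v × X s ≋ unit w × restrict U′ s ≋ unit w
      entry v w = case inImage? (e T) (e-injective T) v , inImage? (e T) (e-injective T) w of λ where
        (yes v∈ , _) → inj₁ (trans (≡⇒≋ (X-image v∈) w) (sym (restrict-image v∈ w)))
        -- The clearing row is `w` itself: it lies in the block, so it is a unit row in both
        -- matrices, and it differs from `v`, which lies outside.
        (no v∉ , yes w∈) → inj₂ (w , (λ { ≡.refl → v∉ w∈ }) , ≡⇒≋ (X-image w∈) , restrict-image w∈)
        (no v∉ , no w∉) → inj₁ (trans (≡⇒≋ (X-off v∉) w) (reflexive (outside⇒same (notT v∉) (notT w∉))))

    -- A linear extension of `≺` is never constructed; splitting off a minimal element of the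
    -- shrinking set `U` visits the blocks in such an order.
    det-restrict : ∀ U → Acc Subset._⊂_ U → det (restrict U) ≈ product (factors U)
    det-restrict U (acc rec) with Subset.nonempty? U
    ... | no empty = begin
      det (restrict U)       ≈⟨ det-cong {n} (λ v w → reflexive (restrict-outside U {v} {w} (λ (v∈U , _) → empty (_ , v∈U)))) ⟩
      det (unit {n})         ≈⟨ det-unit n ⟩
      1#                     ≈⟨ product-replicate-one k ⟨
      product (λ (_ : Fin k) → 1#)   ≈⟨ product-cong (λ i → reflexive (≡.sym (factors-outside U (λ i∈U → empty (i , i∈U))))) ⟩
      product (factors U)    ∎
    ... | yes nonempty with minimal-element isSPO _≺?_ U nonempty
    ...   | T , T∈U , minimal = begin
      det (restrict U)                                ≈⟨ remove-minimal U T∈U minimal ⟩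
      det (block T) * det (restrict (U Subset.- T))   ≈⟨ *-cong (reflexive (≡.sym (factors-inside U T∈U))) (det-restrict (U Subset.- T) (rec (Subset.x∈p⇒p-x⊂p T∈U))) ⟩
      factors U T * product (factors (U Subset.- T))  ≈⟨ product-extract T (reflexive (factors-outside (U Subset.- T) (x∉p-x U T))) agree ⟨
      product (factors U)                             ∎
      where
      agree : ∀ i → i ≢ T → factors U i ≈ factors (U Subset.- T) i
      agree i i≢T = case i ∈? U of λ where
        (yes i∈U) → reflexive (≡.trans (factors-inside U i∈U) (≡.sym (factors-inside (U Subset.- T) (Subset.x∈p∧x≢y⇒x∈p-y i∈U i≢T))))
        (no i∉U) → reflexive (≡.trans (factors-outside U i∉U)
                                      (≡.sym (factors-outside (U Subset.- T) (i∉U ∘ Subset.p─q⊆p _ _))))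

    det-blockTriangular : det M ≈ product (λ i → det (block i))
    det-blockTriangular = begin
      det M                              ≈⟨ det-cong {n} (λ v w → reflexive (≡.sym (restrict-inside Subset.⊤ {v} {w} Subset.∈⊤ Subset.∈⊤))) ⟩
      det (restrict Subset.⊤)            ≈⟨ det-restrict Subset.⊤ (⊂-wellFounded Subset.⊤) ⟩
      product (factors Subset.⊤)         ≈⟨ product-cong {k} (λ i → reflexive (factors-inside Subset.⊤ {i} Subset.∈⊤)) ⟩
      product (λ i → det (block i))      ∎

-- Unique factorisation into linear factors

module PolynomialFunctions (K : CommutativeRing 0ℓ 0ℓ) where
  open CommutativeRing K hiding (zero)
  open IntegerSolver K
  open BlockTriangular K
  open GroupProperties +-group using (x∙y⁻¹≈ε⇒x≈y; x≈y⇒x∙y⁻¹≈ε)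
  open SetoidReasoning setoid

  -- Polynomial functions of degree less than the index.
  data Polynomial : ℕ → (Carrier → Carrier) → Set where
    nil  : ∀ {g} → (∀ x → g x ≈ 0#) → Polynomial zero g
    cons : ∀ {n g q} c → Polynomial n q → (∀ x → g x ≈ c + x * q x) → Polynomial (suc n) g

  weaken : ∀ {n g} → Polynomial n g → Polynomial (suc n) g
  weaken (nil g≈0)     = cons 0# (nil {const 0#} (λ x → refl))
                              (λ x → trans (g≈0 x) (solve 1 (λ x → con ℤ.0ℤ := con ℤ.0ℤ :+ x :* con ℤ.0ℤ) refl x))
  weaken (cons c q eq) = cons c (weaken q) eq

  combine : ∀ {n g h} → Polynomial n g → ∀ a → Polynomial n h → Polynomial n (λ x → g x + a * h x)
  combine (nil g≈0) a (nil h≈0) = nil (λ x → trans (+-cong (g≈0 x) (*-congˡ (h≈0 x)))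
    (solve 1 (λ a → con ℤ.0ℤ :+ a :* con ℤ.0ℤ := con ℤ.0ℤ) refl a))
  combine (cons c p eq) a (cons d q eq′) = cons (c + a * d) (combine p a q)
    (λ x → trans (+-cong (eq x) (*-congˡ (eq′ x)))
      (solve 6 (λ a c d x p q → (c :+ x :* p) :+ a :* (d :+ x :* q) := (c :+ a :* d) :+ x :* (p :+ a :* q)) refl a c d x _ _))

  addConstant : ∀ {n g} c → Polynomial (suc n) g → Polynomial (suc n) (λ x → c + g x)
  addConstant c (cons d q eq) = cons (c + d) q (λ x → trans (+-congˡ (eq x)) (sym (+-assoc _ _ _)))

  mulLinear : ∀ {n g} a → Polynomial n g → Polynomial (suc n) (λ x → (x + - a) * g x)
  mulLinear a (nil g≈0) = cons 0# (nil {const 0#} (λ x → refl))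
    (λ x → trans (*-congˡ (g≈0 x))
      (solve 2 (λ a x → (x :+ :- a) :* con ℤ.0ℤ := con ℤ.0ℤ :+ x :* con ℤ.0ℤ) refl a x))
  mulLinear a (cons c q eq) = cons (- (a * c)) (addConstant c (mulLinear a q))
    (λ x → trans (*-congˡ (eq x))
      (solve 4 (λ a c x q → (x :+ :- a) :* (c :+ x :* q) := :- (a :* c) :+ x :* (c :+ (x :+ :- a) :* q)) refl a c x _))

  linearProduct : ∀ {n} → Vector Carrier n → Carrier → Carrier
  linearProduct as x = product (λ j → x + - as j)

  linearProduct-polynomial : ∀ {n} (as : Vector Carrier n) → Polynomial (suc n) (linearProduct as)
  linearProduct-polynomial {zero}  as = cons 1# (nil {const 0#} (λ x → refl))
    (λ x → solve 1 (λ x → con ℤ.1ℤ := con ℤ.1ℤ :+ x :* con ℤ.0ℤ) refl x)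
  linearProduct-polynomial {suc n} as = mulLinear (as zero) (linearProduct-polynomial (as ∘ suc))

  -- Synthetic division. If `q` has quotient `h` at `a`, then `x q(x) - a q(a) = (x - a) q(x) + a
  -- (q(x) - q(a))` shows that `c + x q(x)` has quotient `q + a h`.
  factor : ∀ {n g} → Polynomial (suc n) g → ∀ a →
           ∃[ h ] Polynomial n h × (∀ x → g x ≈ g a + (x + - a) * h x)
  factor {zero} {g} (cons {q = q} c (nil q≈0) eq) a = q , nil q≈0 , λ x → begin
    g x                          ≈⟨ value x ⟩
    c                            ≈⟨ solve 3 (λ c x a → c := c :+ (x :+ :- a) :* con ℤ.0ℤ) refl c x a ⟩
    c + (x + - a) * 0#           ≈⟨ +-cong (value a) (*-congˡ (q≈0 x)) ⟨
    g a + (x + - a) * q x        ∎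
    where
    value : ∀ x → g x ≈ c
    value x = begin
      g x           ≈⟨ eq x ⟩
      c + x * q x   ≈⟨ +-congˡ (*-congˡ (q≈0 x)) ⟩
      c + x * 0#    ≈⟨ solve 2 (λ c x → c :+ x :* con ℤ.0ℤ := c) refl c x ⟩
      c             ∎
  factor {suc n} {g} (cons {q = q} c pq eq) a with factor pq a
  ... | h , ph , eq′ = (λ x → q x + a * h x) , combine pq a (weaken ph) , λ x → begin
    g x
      ≈⟨ eq x ⟩
    c + x * q x
      -- The identity needs `eq′`, which the solver does not know, so the defect of `eq′` is carried
      -- as an extra last summand and removed next.
      ≈⟨ solve 6 (λ a c x q qa h → c :+ x :* q :=
           ((c :+ a :* qa) :+ (x :+ :- a) :* (q :+ a :* h)) :+ a :* (q :+ :- (qa :+ (x :+ :- a) :* h)))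
         refl a c x (q x) (q a) (h x) ⟩
    c + a * q a + (x + - a) * (q x + a * h x) + a * (q x + - (q a + (x + - a) * h x))
      ≈⟨ +-cong (+-congʳ (sym (eq a))) (*-congˡ (x≈y⇒x∙y⁻¹≈ε (eq′ x))) ⟩
    g a + (x + - a) * (q x + a * h x) + a * 0#
      ≈⟨ solve 2 (λ y a → y :+ a :* con ℤ.0ℤ := y) refl _ a ⟩
    g a + (x + - a) * (q x + a * h x) ∎

  module InfiniteDomain
    (0≉1 : 0# ≉ 1#)
    (zero-product : ∀ {x y} → x * y ≈ 0# → x ≈ 0# ⊎ y ≈ 0#)
    (avoid : ∀ (L : List Carrier) → ∃[ a ] All (a ≉_) L)
    where

    cancel-linear : ∀ {x a y} → x ≉ a → (x + - a) * y ≈ 0# → y ≈ 0#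
    cancel-linear {x} {a} x≉a eq with zero-product eq
    ... | inj₁ x-a≈0 = contradiction (x∙y⁻¹≈ε⇒x≈y x a x-a≈0) x≉a
    ... | inj₂ y≈0   = y≈0

    -- A root `a` outside `L` is divided out. The quotient is known to vanish only away from `a`, so
    -- `a` joins the list of exceptions while the degree bound drops.
    zero-off-list : ∀ {n g} → Polynomial n g → ∀ L → (∀ x → All (x ≉_) L → g x ≈ 0#) → ∀ x → g x ≈ 0#
    zero-off-list (nil g≈0) L off = g≈0
    zero-off-list {suc n} {g} p@(cons _ _ _) L off x with avoid L
    ... | a , a∉L with factor p a
    ...   | h , ph , eq = begin
      g x                      ≈⟨ reduced x ⟩
      (x + - a) * h x          ≈⟨ *-congˡ (zero-off-list ph (a List.∷ L) h-off x) ⟩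
      (x + - a) * 0#           ≈⟨ zeroʳ _ ⟩
      0#                       ∎
      where
      reduced : ∀ x → g x ≈ (x + - a) * h x
      reduced x = trans (eq x) (trans (+-congʳ (off a a∉L)) (+-identityˡ _))
      h-off : ∀ x → All (x ≉_) (a List.∷ L) → h x ≈ 0#
      h-off x (x≉a All.∷ x∉L) = cancel-linear x≉a (trans (sym (reduced x)) (off x x∉L))

    linearProduct-root : ∀ {n} (as : Vector Carrier n) j → linearProduct as (as j) ≈ 0#
    linearProduct-root {suc n} as j = begin
      linearProduct as (as j)                                    ≈⟨ product-remove {i = j} (λ i → as j + - as i) ⟩
      (as j + - as j) * linearProduct (removeAt as j) (as j)     ≈⟨ *-congʳ (-‿inverseʳ _) ⟩
      0# * linearProduct (removeAt as j) (as j)                  ≈⟨ zeroˡ _ ⟩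
      0#                                                         ∎

    root-of-linearProduct : ∀ {n} (as : Vector Carrier n) x → linearProduct as x ≈ 0# → ∃[ j ] x ≈ as j
    root-of-linearProduct {zero}  as x eq = contradiction (sym eq) 0≉1
    root-of-linearProduct {suc n} as x eq with zero-product eq
    ... | inj₁ x-a≈0 = zero , x∙y⁻¹≈ε⇒x≈y x (as zero) x-a≈0
    ... | inj₂ eq′ with root-of-linearProduct (as ∘ suc) x eq′
    ...   | j , x≈aj = suc j , x≈aj

    -- Pointwise cancellation of the common factor fails at the root itself. The difference of the
    -- two quotients is a polynomial function vanishing everywhere else, hence also there.
    cancel-root : ∀ {m n} (as : Vector Carrier (suc m)) (bs : Vector Carrier (suc n)) j →
                  as zero ≈ bs j → (∀ x → linearProduct as x ≈ linearProduct bs x) →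
                  ∀ x → linearProduct (as ∘ suc) x ≈ linearProduct (removeAt bs j) x
    cancel-root {m} {n} as bs j a≈b eq x = x∙y⁻¹≈ε⇒x≈y _ _ (begin
      A x + - B x            ≈⟨ solve 2 (λ y z → y :+ :- z := y :+ (:- con ℤ.1ℤ) :* z) refl (A x) (B x) ⟩
      A x + - 1# * B x       ≈⟨ difference x ⟩
      0#                     ∎)
      where
      A B : Carrier → Carrier
      A = linearProduct (as ∘ suc)
      B = linearProduct (removeAt bs j)

      a : Carrier
      a = as zero

      scaled : ∀ x → (x + - a) * (A x + - 1# * B x) ≈ 0#
      scaled x = begin
        (x + - a) * (A x + - 1# * B x)
          ≈⟨ solve 3 (λ y p q → y :* (p :+ (:- con ℤ.1ℤ) :* q) := y :* p :+ :- (y :* q)) refl (x + - a) (A x) (B x) ⟩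
        (x + - a) * A x + - ((x + - a) * B x)
          ≈⟨ +-congˡ (-‿cong (*-congʳ (+-congˡ (-‿cong a≈b)))) ⟩
        linearProduct as x + - ((x + - bs j) * B x)
          ≈⟨ +-congˡ (-‿cong (product-remove {i = j} (λ i → x + - bs i))) ⟨
        linearProduct as x + - linearProduct bs x
          ≈⟨ x≈y⇒x∙y⁻¹≈ε (eq x) ⟩
        0# ∎

      weaken-by : ∀ {g k} l → Polynomial k g → Polynomial (l ℕ.+ k) g
      weaken-by zero    p = p
      weaken-by (suc l) p = weaken (weaken-by l p)

      -- m = n is not known at this point, so the two degree bounds are raised
      -- to a common one.
      difference : ∀ x → A x + - 1# * B x ≈ 0#
      difference = zero-off-list
        (combine (≡.subst (λ k → Polynomial k A) (ℕ.+-comm (suc n) (suc m))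
                   (weaken-by (suc n) (linearProduct-polynomial (as ∘ suc))))
                 (- 1#)
                 (weaken-by (suc m) (linearProduct-polynomial (removeAt bs j))))
        (a List.∷ List.[])
        (λ { x (x≉a All.∷ All.[]) → cancel-linear x≉a (scaled x) })

    module _ (S : CommutativeMonoid 0ℓ 0ℓ) where
      private
        module S = CommutativeMonoid S
        open Summation S using () renaming (sum to sumₛ; sum-remove to sumₛ-remove)

      -- Equality of multisets is expressed by equal sums of every `φ` into a commutative monoid,
      -- which avoids permutations. The first root on the left occurs on the right, and one copy is
      -- removed from each side. The lengths may differ in the statement because the equation itself
      -- forces them to agree.
      sum-over-roots : ∀ {m n} (as : Vector Carrier m) (bs : Vector Carrier n) →
        (∀ x → linearProduct as x ≈ linearProduct bs x) →
        (φ : Carrier → S.Carrier) → (∀ {x y} → x ≈ y → φ x S.≈ φ y) →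
        sumₛ (φ ∘ as) S.≈ sumₛ (φ ∘ bs)
      sum-over-roots {zero}  {zero}  as bs eq φ φ-cong = S.refl
      sum-over-roots {zero}  {suc n} as bs eq φ φ-cong =
        contradiction (sym (trans (eq (bs zero)) (linearProduct-root bs zero))) 0≉1
      sum-over-roots {suc m} {n} as bs eq φ φ-cong
        with root-of-linearProduct bs (as zero) (trans (sym (eq (as zero))) (linearProduct-root as zero))
      -- The index `j` of the matching root rules out an empty right-hand list.
      sum-over-roots {suc m} {suc n} as bs eq φ φ-cong | j , a≈b = S.trans
        (S.∙-cong (φ-cong a≈b) (sum-over-roots (as ∘ suc) (removeAt bs j) (cancel-root as bs j a≈b eq) φ φ-cong))
        (S.sym (sumₛ-remove {i = j} (φ ∘ bs)))

-- Real and complex numbers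

module RealProperties (R : Reals) where
  open Reals R hiding (zero)
  open IsStrictTotalOrder isStrictTotalOrder using (<-respʳ-≈; <-respˡ-≈)
    renaming (trans to <-trans; irrefl to <-irrefl; _≟_ to _≟ᵣ_)
  open IntegerSolver commutativeRing
  open MonoidMultiples +-monoid using (×-homo-+)
  open SetoidReasoning setoid

  ≤-refl : ∀ {x} → x ≤ x
  ≤-refl = inj₂ refl

  <-≤-trans : ∀ {x y z} → x < y → y ≤ z → x < z
  <-≤-trans x<y (inj₁ y<z) = <-trans x<y y<z
  <-≤-trans x<y (inj₂ y≈z) = <-respʳ-≈ y≈z x<y

  ≤-<-trans : ∀ {x y z} → x ≤ y → y < z → x < z
  ≤-<-trans (inj₁ x<y) y<z = <-trans x<y y<z
  ≤-<-trans (inj₂ x≈y) y<z = <-respˡ-≈ (sym x≈y) y<z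

  ≤-trans : ∀ {x y z} → x ≤ y → y ≤ z → x ≤ z
  ≤-trans (inj₁ x<y) y≤z        = inj₁ (<-≤-trans x<y y≤z)
  ≤-trans (inj₂ x≈y) (inj₁ y<z) = inj₁ (<-respˡ-≈ (sym x≈y) y<z)
  ≤-trans (inj₂ x≈y) (inj₂ y≈z) = inj₂ (trans x≈y y≈z)

  ≮⇒≥ : ∀ {x y} → ¬ x < y → y ≤ x
  ≮⇒≥ {x} {y} x≮y with compare x y
  ... | tri< x<y _ _ = contradiction x<y x≮y
  ... | tri≈ _ x≈y _ = inj₂ (sym x≈y)
  ... | tri> _ _ y<x = inj₁ y<x

  ≤⇒≯ : ∀ {x y} → x ≤ y → ¬ y < x
  ≤⇒≯ x≤y y<x = <-irrefl refl (<-≤-trans y<x x≤y)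

  +-monoʳ-≤ : ∀ z {x y} → x ≤ y → z + x ≤ z + y
  +-monoʳ-≤ z (inj₁ x<y) = inj₁ (+-monoʳ-< z x<y)
  +-monoʳ-≤ z (inj₂ x≈y) = inj₂ (+-congˡ x≈y)

  +-mono-≤ : ∀ {x y u v} → x ≤ y → u ≤ v → x + u ≤ y + v
  +-mono-≤ {x} {y} {u} {v} x≤y u≤v = ≤-trans (+-monoʳ-≤ x u≤v)
    (≤-trans (inj₂ (+-comm x v)) (≤-trans (+-monoʳ-≤ v x≤y) (inj₂ (+-comm v y))))

  sum-mono-≤ : ∀ {n} (f g : Vector Carrier n) → (∀ i → f i ≤ g i) → sum f ≤ sum g
  sum-mono-≤ {zero}  f g f≤g = ≤-refl
  sum-mono-≤ {suc n} f g f≤g = +-mono-≤ (f≤g zero) (sum-mono-≤ (f ∘ suc) (g ∘ suc) (f≤g ∘ suc))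

  positive-+ : ∀ {x y} → 0# < x → 0# ≤ y → 0# < x + y
  positive-+ {x} {y} 0<x 0≤y = <-≤-trans 0<x
    (≤-trans (inj₂ (sym (+-identityʳ x))) (+-monoʳ-≤ x 0≤y))

  neg-positive : ∀ {x} → x < 0# → 0# < - x
  neg-positive {x} x<0 = <-respˡ-≈ (-‿inverseˡ x) (<-respʳ-≈ (+-identityʳ (- x)) (+-monoʳ-< (- x) x<0))

  difference-positive : ∀ {x y} → x < y → 0# < y + - x
  difference-positive {x} {y} x<y = <-respˡ-≈ (-‿inverseˡ x) (<-respʳ-≈ (+-comm (- x) y) (+-monoʳ-< (- x) x<y))

  difference-nonpos : ∀ {x y} → y ≤ x → y + - x ≤ 0#
  difference-nonpos {x} {y} y≤x = ≤-trans (inj₂ (+-comm y (- x)))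
    (≤-trans (+-monoʳ-≤ (- x) y≤x) (inj₂ (-‿inverseˡ x)))

  square-positive : ∀ {x} → x ≉ 0# → 0# < x * x
  square-positive {x} x≉0 with compare x 0#
  ... | tri< x<0 _ _ = <-respʳ-≈ (solve 1 (λ x → (:- x) :* (:- x) := x :* x) refl x)
                         (*-pos (neg-positive x<0) (neg-positive x<0))
  ... | tri≈ _ x≈0 _ = contradiction x≈0 x≉0
  ... | tri> _ _ 0<x = *-pos 0<x 0<x

  square-nonneg : ∀ x → 0# ≤ x * x
  square-nonneg x with x ≟ᵣ 0#
  ... | yes x≈0 = inj₂ (sym (trans (*-congˡ x≈0) (zeroʳ x)))
  ... | no x≉0  = inj₁ (square-positive x≉0)

  0<1 : 0# < 1#
  0<1 = <-respʳ-≈ (*-identityˡ 1#) (square-positive (0≉1 ∘ sym))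

  x<x+1 : ∀ x → x < x + 1#
  x<x+1 x = <-respˡ-≈ (+-identityʳ x) (+-monoʳ-< x 0<1)

  zero-product : ∀ {x y} → x * y ≈ 0# → x ≈ 0# ⊎ y ≈ 0#
  zero-product {x} {y} xy≈0 with x ≟ᵣ 0#
  ... | yes x≈0 = inj₁ x≈0
  ... | no x≉0  = inj₂ (begin
    y                      ≈⟨ *-identityˡ y ⟨
    1# * y                 ≈⟨ *-congʳ (⁻¹-inverseʳ x≉0) ⟨
    x * x ⁻¹ * y           ≈⟨ solve 3 (λ x i y → x :* i :* y := i :* (x :* y)) refl x (x ⁻¹) y ⟩
    x ⁻¹ * (x * y)         ≈⟨ *-congˡ xy≈0 ⟩
    x ⁻¹ * 0#              ≈⟨ zeroʳ _ ⟩
    0#                     ∎)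

  times-nonneg : ∀ n → 0# ≤ n times 1#
  times-nonneg zero    = ≤-refl
  times-nonneg (suc n) = inj₁ (positive-+ 0<1 (times-nonneg n))

  -- An ordered field has characteristic zero, since sums of positive ones stay positive.
  times-nonzero : ∀ n .{{_ : ℕ.NonZero n}} → n times 1# ≉ 0#
  times-nonzero (suc n) eq = <-irrefl (sym eq) (positive-+ 0<1 (times-nonneg n))

  sum-times : ∀ {k} (f : Vector ℕ k) → sum (λ i → f i times 1#) ≈ sumℕ f times 1#
  sum-times {zero}  f = refl
  sum-times {suc k} f = trans (+-congˡ (sum-times (f ∘ suc))) (sym (×-homo-+ 1# (f zero) (sumℕ (f ∘ suc))))

  /ₙ-cancel : ∀ a b .{{_ : ℕ.NonZero b}} → (b times 1#) * (a /ₙ b) ≈ a times 1#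
  /ₙ-cancel a b = begin
    (b times 1#) * ((a times 1#) * (b times 1#) ⁻¹)
      ≈⟨ solve 3 (λ b a i → b :* (a :* i) := a :* (b :* i)) refl (b times 1#) (a times 1#) _ ⟩
    (a times 1#) * ((b times 1#) * (b times 1#) ⁻¹)   ≈⟨ *-congˡ (⁻¹-inverseʳ (times-nonzero b)) ⟩
    (a times 1#) * 1#                                 ≈⟨ *-identityʳ _ ⟩
    a times 1#                                        ∎

  ∣∣-cong : ∀ {x y} → x ≈ y → ∣ x ∣ᵣ ≈ ∣ y ∣ᵣ
  ∣∣-cong {x} {y} x≈y with x <? 0# | y <? 0#
  ... | yes _   | yes _   = -‿cong x≈y
  ... | no _    | no _    = x≈y
  ... | yes x<0 | no y≮0  = contradiction (<-respˡ-≈ x≈y x<0) y≮0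
  ... | no x≮0  | yes y<0 = contradiction (<-respˡ-≈ (sym x≈y) y<0) x≮0

  ∣∣-nonneg : ∀ {x} → 0# ≤ x → ∣ x ∣ᵣ ≈ x
  ∣∣-nonneg {x} 0≤x = reflexive (≡.cong (λ b → if b then - x else x) (dec-false (x <? 0#) (≤⇒≯ 0≤x)))

  ∣∣-nonpos : ∀ {x} → x ≤ 0# → ∣ x ∣ᵣ ≈ - x
  ∣∣-nonpos {x} (inj₁ x<0) = reflexive (≡.cong (λ b → if b then - x else x) (dec-true (x <? 0#) x<0))
  -- At zero the absolute value takes the branch without negation, so `0# ≈ - 0#` has to bridge the
  -- two.
  ∣∣-nonpos {x} (inj₂ x≈0) = begin
    ∣ x ∣ᵣ   ≈⟨ ∣∣-nonneg (inj₂ (sym x≈0)) ⟩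
    x        ≈⟨ x≈0 ⟩
    0#       ≈⟨ solve 0 (con ℤ.0ℤ := :- con ℤ.0ℤ) refl ⟩
    - 0#     ≈⟨ -‿cong x≈0 ⟨
    - x      ∎

  x≤∣x∣ : ∀ x → x ≤ ∣ x ∣ᵣ
  x≤∣x∣ x with x <? 0#
  ... | yes x<0 = inj₁ (<-trans x<0 (neg-positive x<0))
  ... | no _    = ≤-refl

  -x≤∣x∣ : ∀ x → - x ≤ ∣ x ∣ᵣ
  -x≤∣x∣ x with x <? 0#
  ... | yes _  = ≤-refl
  ... | no x≮0 with ≮⇒≥ x≮0
  ...   | inj₂ 0≈x = inj₂ (trans (-‿cong (sym 0≈x)) (trans (solve 0 (:- con ℤ.0ℤ := con ℤ.0ℤ) refl) 0≈x))
  ...   | inj₁ 0<x = inj₁ (<-trans (<-respˡ-≈ (+-identityʳ (- x)) (<-respʳ-≈ (-‿inverseˡ x) (+-monoʳ-< (- x) 0<x))) 0<x)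

  -- Assembled from the fields of `complexRawRing R`, so that determinants and products over it
  -- agree by computation with those in `AreEigenvalues`.
  complexRing : CommutativeRing 0ℓ 0ℓ
  complexRing = record
    { RawRing′
    ; isCommutativeRing = record
      { isRing = record
        { +-isAbelianGroup = record
          { isGroup = record
            { isMonoid = record
              { isSemigroup = record
                { isMagma = record
                  { isEquivalence = record
                    { refl  = refl , refl
                    ; sym   = λ (p , q) → sym p , sym q
                    ; trans = λ (p , q) (p′ , q′) → trans p p′ , trans q q′
                    }
                  ; ∙-cong = λ (p , q) (p′ , q′) → +-cong p p′ , +-cong q q′
                  }
                ; assoc = λ _ _ _ → +-assoc _ _ _ , +-assoc _ _ _
                }
              ; identity = (λ _ → +-identityˡ _ , +-identityˡ _) , (λ _ → +-identityʳ _ , +-identityʳ _)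
              }
            ; inverse = (λ _ → -‿inverseˡ _ , -‿inverseˡ _) , (λ _ → -‿inverseʳ _ , -‿inverseʳ _)
            ; ⁻¹-cong = λ (p , q) → -‿cong p , -‿cong q
            }
          ; comm = λ _ _ → +-comm _ _ , +-comm _ _
          }
        ; *-cong = λ (p , q) (p′ , q′) →
            +-cong (*-cong p p′) (-‿cong (*-cong q q′)) , +-cong (*-cong p q′) (*-cong q p′)
        ; *-assoc = λ (a , b) (c , d) (e , f) →
            solve 6 (λ a b c d e f → (a :* c :+ :- (b :* d)) :* e :+ :- ((a :* d :+ b :* c) :* f) :=
                                     a :* (c :* e :+ :- (d :* f)) :+ :- (b :* (c :* f :+ d :* e))) refl a b c d e f ,
            solve 6 (λ a b c d e f → (a :* c :+ :- (b :* d)) :* f :+ (a :* d :+ b :* c) :* e :=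
                                     a :* (c :* f :+ d :* e) :+ b :* (c :* e :+ :- (d :* f))) refl a b c d e f
        ; *-identity =
            (λ (a , b) → solve 2 (λ a b → con ℤ.1ℤ :* a :+ :- (con ℤ.0ℤ :* b) := a) refl a b ,
                         solve 2 (λ a b → con ℤ.1ℤ :* b :+ con ℤ.0ℤ :* a := b) refl a b) ,
            (λ (a , b) → solve 2 (λ a b → a :* con ℤ.1ℤ :+ :- (b :* con ℤ.0ℤ) := a) refl a b ,
                         solve 2 (λ a b → a :* con ℤ.0ℤ :+ b :* con ℤ.1ℤ := b) refl a b)
        ; distrib =
            (λ (a , b) (c , d) (e , f) →
              solve 6 (λ a b c d e f → a :* (c :+ e) :+ :- (b :* (d :+ f)) :=
                                       (a :* c :+ :- (b :* d)) :+ (a :* e :+ :- (b :* f))) refl a b c d e f ,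
              solve 6 (λ a b c d e f → a :* (d :+ f) :+ b :* (c :+ e) :=
                                       (a :* d :+ b :* c) :+ (a :* f :+ b :* e)) refl a b c d e f) ,
            (λ (a , b) (c , d) (e , f) →
              solve 6 (λ a b c d e f → (c :+ e) :* a :+ :- ((d :+ f) :* b) :=
                                       (c :* a :+ :- (d :* b)) :+ (e :* a :+ :- (f :* b))) refl a b c d e f ,
              solve 6 (λ a b c d e f → (c :+ e) :* b :+ (d :+ f) :* a :=
                                       (c :* b :+ d :* a) :+ (e :* b :+ f :* a)) refl a b c d e f)
        }
      ; *-comm = λ (a , b) (c , d) →
          solve 4 (λ a b c d → a :* c :+ :- (b :* d) := c :* a :+ :- (d :* b)) refl a b c d ,
          solve 4 (λ a b c d → a :* d :+ b :* c := c :* b :+ d :* a) refl a b c d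
      }
    }
    where module RawRing′ = RawRing (complexRawRing R)

  private module C = CommutativeRing complexRing

  _≟C_ : Decidable C._≈_
  (a , b) ≟C (c , d) = (a ≟ᵣ c) ×-dec (b ≟ᵣ d)

  complex-0≉1 : C.0# C.≉ C.1#
  complex-0≉1 (0≈1 , _) = 0≉1 0≈1

  -- If z = a + bi is nonzero, multiplying zw = 0 by the conjugate of z gives
  -- (a² + b²) w = 0, where a² + b² is positive.
  complex-zero-product : ∀ {z w} → z C.* w C.≈ C.0# → z C.≈ C.0# ⊎ w C.≈ C.0#
  complex-zero-product {z@(a , b)} {c , d} (p , q) with z ≟C C.0#
  ... | yes z≈0 = inj₁ z≈0
  ... | no z≉0  = inj₂ (cancel (begin
      (a * a + b * b) * c
        ≈⟨ solve 4 (λ a b c d → (a :* a :+ b :* b) :* c := a :* (a :* c :+ :- (b :* d)) :+ b :* (a :* d :+ b :* c)) refl a b c d ⟩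
      a * (a * c + - (b * d)) + b * (a * d + b * c)   ≈⟨ +-cong (*-congˡ p) (*-congˡ q) ⟩
      a * 0# + b * 0#                                 ≈⟨ solve 2 (λ a b → a :* con ℤ.0ℤ :+ b :* con ℤ.0ℤ := con ℤ.0ℤ) refl a b ⟩
      0#                                              ∎) , cancel (begin
      (a * a + b * b) * d
        ≈⟨ solve 4 (λ a b c d → (a :* a :+ b :* b) :* d := a :* (a :* d :+ b :* c) :+ :- (b :* (a :* c :+ :- (b :* d)))) refl a b c d ⟩
      a * (a * d + b * c) + - (b * (a * c + - (b * d)))   ≈⟨ +-cong (*-congˡ q) (-‿cong (*-congˡ p)) ⟩
      a * 0# + - (b * 0#)                             ≈⟨ solve 2 (λ a b → a :* con ℤ.0ℤ :+ :- (b :* con ℤ.0ℤ) := con ℤ.0ℤ) refl a b ⟩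
      0#                                              ∎))
    where
    norm-positive : 0# < a * a + b * b
    norm-positive with a ≟ᵣ 0# | b ≟ᵣ 0#
    ... | no a≉0  | _       = positive-+ (square-positive a≉0) (square-nonneg b)
    ... | yes _   | no b≉0  = <-respʳ-≈ (+-comm _ _) (positive-+ (square-positive b≉0) (square-nonneg a))
    ... | yes a≈0 | yes b≈0 = contradiction (a≈0 , b≈0) z≉0

    cancel : ∀ {y} → (a * a + b * b) * y ≈ 0# → y ≈ 0#
    cancel eq with zero-product eq
    ... | inj₁ N≈0 = contradiction norm-positive (<-irrefl (sym N≈0))
    ... | inj₂ y≈0 = y≈0

  upper-bound : ∀ (L : List Carrier) → ∃[ a ] All (_< a) L
  upper-bound List.[] = 0# , All.[]
  upper-bound (x List.∷ L) with upper-bound L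
  ... | a , L<a with x <? a
  ...   | yes x<a = a , x<a All.∷ L<a
  ...   | no x≮a  = x + 1# , x<x+1 x All.∷ All.map (λ y<a → <-trans y<a (≤-<-trans (≮⇒≥ x≮a) (x<x+1 x))) L<a

  -- A real number exceeding all the real parts in the list differs from every entry.
  complex-avoid : ∀ (L : List (ℂ R)) → ∃[ a ] All (a C.≉_) L
  complex-avoid L with upper-bound (List.map proj₁ L)
  ... | a , L<a = (a , 0#) , All.map (λ z<a (a≈z , _) → <-irrefl (sym a≈z) z<a) (All.map⁻ L<a)

-- Strong components

record Enumeration {n} (P : Fin n → Set) : Set where
  field
    size      : ℕ
    element   : Fin size → Fin n
    injective : Injective _≡_ _≡_ element
    sound     : ∀ a → P (element a)
    complete  : ∀ {v} → P v → ∃[ a ] element a ≡ v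

enumerate : ∀ {n} {P : Fin n → Set} → Unary.Decidable P → Enumeration P
enumerate {zero}  P? = record
  { size = 0 ; element = λ () ; injective = λ {} ; sound = λ () ; complete = λ {} }
enumerate {suc n} {P} P? with P? zero | enumerate (P? ∘ suc)
... | yes P0 | E = record
  { size      = suc size
  ; element   = λ { zero → zero ; (suc a) → suc (element a) }
  ; injective = λ { {zero} {zero} _ → ≡.refl
                  ; {suc a} {suc b} eq → ≡.cong suc (injective (suc-injective eq)) }
  ; sound     = λ { zero → P0 ; (suc a) → sound a }
  ; complete  = λ { {zero} _ → zero , ≡.refl
                  ; {suc v} Pv → let a , eq = complete Pv in suc a , ≡.cong suc eq }
  } where open Enumeration E
... | no ¬P0 | E = record
  { size      = size
  ; element   = suc ∘ element
  ; injective = injective ∘ suc-injective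
  ; sound     = sound
  ; complete  = λ { {zero} P0 → contradiction P0 ¬P0
                  ; {suc v} Pv → let a , eq = complete Pv in a , ≡.cong suc eq }
  } where open Enumeration E

module Condensation (D : Digraph) where
  open Digraph D using (order; arc; Arc)
  open SubDigraph

  Reaches : Rel (Fin order) 0ℓ
  Reaches = Star Arc

  Mutual : Rel (Fin order) 0ℓ
  Mutual v w = Reaches v w × Reaches w v

  -- Excluded middle holds under double negation for each pair of vertices, and double negation
  -- commutes with finite conjunctions. This replaces a search through walks of bounded length.
  reaches-decidable-¬¬ : DoubleNegation (Decidable Reaches)
  reaches-decidable-¬¬ = Fin.sequence rawApplicative (λ v → Fin.sequence rawApplicative (λ w → ¬¬-excluded-middle))
    where open RawMonad ¬¬-Monad using (rawApplicative)

  hasArc⇒arc : ∀ (H : SubDigraph D) {v w} → HasArc H v w → Arc v w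
  hasArc⇒arc H (a , b , ≡.refl , ≡.refl , ab) = vertex-arc H ab

  hasArc⇒hasVertexˡ : ∀ (H : SubDigraph D) {v w} → HasArc H v w → HasVertex H v
  hasArc⇒hasVertexˡ H (a , _ , eq , _) = a , eq

  hasArc⇒hasVertexʳ : ∀ (H : SubDigraph D) {v w} → HasArc H v w → HasVertex H w
  hasArc⇒hasVertexʳ H (_ , b , _ , eq , _) = b , eq

  stronglyConnected⇒mutual : ∀ (H : SubDigraph D) → Digraph.StronglyConnected (digraph H) →
                             ∀ {v w} → HasVertex H v → HasVertex H w → Mutual v w
  stronglyConnected⇒mutual H sc (a , ≡.refl) (b , ≡.refl) with a ≟ b
  ... | yes ≡.refl = ε , ε
  ... | no a≢b with sc a b a≢b
  ...   | p , q = gmap (vertex H) (vertex-arc H) p , gmap (vertex H) (vertex-arc H) q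

  ⊑-trans : ∀ {H K L : SubDigraph D} → H ⊑ K → K ⊑ L → H ⊑ L
  ⊑-trans (p , q) (p′ , q′) = (λ v → p′ v ∘ p v) , (λ v w → q′ v w ∘ q v w)

  module _ (reaches? : Decidable Reaches) where

    module _ (v : Fin order) where
      open Enumeration (enumerate (λ w → reaches? v w ×-dec reaches? w v))
        renaming (injective to element-injective)

      component : SubDigraph D
      component = record
        { digraph = record
          { order    = size
          ; nonEmpty = Fin.nonZeroIndex (proj₁ (complete {v} (ε , ε)))
          ; arc      = λ a b → arc (element a) (element b)
          }
        ; vertex           = element
        ; vertex-injective = element-injective
        ; vertex-arc       = λ ab → ab
        }

      mutual⇒hasVertex : ∀ {w} → Mutual v w → HasVertex component w
      mutual⇒hasVertex = complete

      mutual⇒hasArc : ∀ {w w′} → Mutual v w → Mutual v w′ → Arc w w′ → HasArc component w w′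
      mutual⇒hasArc m m′ ww′ with complete m | complete m′
      ... | a , ≡.refl | b , ≡.refl = a , b , ≡.refl , ≡.refl , ww′

      -- A walk between two vertices of the component never leaves it.
      lift-walk : ∀ {x y} → Reaches x y → Reaches v x → Reaches y v →
                  ∀ a b → element a ≡ x → element b ≡ y → Star (Digraph.Arc (digraph component)) a b
      lift-walk ε vx yv a b ≡.refl eq with element-injective eq
      ... | ≡.refl = ε
      lift-walk (xz ◅ zy) vx yv a b ≡.refl eq with complete (vx ◅◅ (xz ◅ ε) , zy ◅◅ yv)
      ... | c , ≡.refl = xz ◅ lift-walk zy (vx ◅◅ (xz ◅ ε)) yv c b ≡.refl eq

      component-stronglyConnected : Digraph.StronglyConnected (digraph component)
      component-stronglyConnected a b _ = walk a b , walk b a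
        where
        walk : ∀ a b → Star (Digraph.Arc (digraph component)) a b
        walk a b = lift-walk (proj₂ (sound a) ◅◅ proj₁ (sound b)) (proj₁ (sound a)) (proj₂ (sound b)) a b ≡.refl ≡.refl

      stronglyConnected⊑component : ∀ H → Digraph.StronglyConnected (digraph H) →
        ∀ {w} → HasVertex H w → Mutual v w → H ⊑ component
      stronglyConnected⊑component H sc {w} w∈H (vw , wv) =
        (λ u u∈H → mutual⇒hasVertex (toMutual u∈H)) ,
        (λ u u′ uu′ → mutual⇒hasArc (toMutual (hasArc⇒hasVertexˡ H uu′))
                                    (toMutual (hasArc⇒hasVertexʳ H uu′)) (hasArc⇒arc H uu′))
        where
        toMutual : ∀ {u} → HasVertex H u → Mutual v u
        toMutual u∈H with stronglyConnected⇒mutual H sc w∈H u∈H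
        ... | wu , uw = vw ◅◅ wu , uw ◅◅ wv

      -- A strongly connected `K` above the component contains `v`, so all its vertices are mutually
      -- reachable with `v`.
      component-isStrongComponent : IsStrongComponent component
      component-isStrongComponent = component-stronglyConnected , λ K sc (vertices , _) →
        stronglyConnected⊑component K sc (vertices v (mutual⇒hasVertex (ε , ε))) (ε , ε)

    module _ {k} (C : Fin k → SubDigraph D) (strong : AreStrongComponents D C) where

      C-stronglyConnected : ∀ i → Digraph.StronglyConnected (digraph (C i))
      C-stronglyConnected i = proj₁ (proj₁ strong i)

      C-mutual : ∀ i {v w} → HasVertex (C i) v → HasVertex (C i) w → Mutual v w
      C-mutual i = stronglyConnected⇒mutual (C i) (C-stronglyConnected i)

      -- The full class of `vertex (C i) a` is strongly connected and contains `C i`, so maximality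
      -- of `C i` turns the inclusion around. This identifies the given components with the classes
      -- of mutual reachability.
      component⊑C : ∀ i a → component (vertex (C i) a) ⊑ C i
      component⊑C i a = proj₂ (proj₁ strong i) (component v) (component-stronglyConnected v)
          (stronglyConnected⊑component v (C i) (C-stronglyConnected i) (a , ≡.refl) (ε , ε))
        where v = vertex (C i) a

      mutual⇒⊑ : ∀ {i j} a b → Mutual (vertex (C i) a) (vertex (C j) b) → C i ⊑ C j
      mutual⇒⊑ {i} {j} a b (ab , ba) = ⊑-trans {C i} {component v} {C j}
          (stronglyConnected⊑component v (C i) (C-stronglyConnected i) (a , ≡.refl) (ba , ab))
          (component⊑C j b)
        where v = vertex (C j) b

      mutual⇒≡ : ∀ {i j} a b → Mutual (vertex (C i) a) (vertex (C j) b) → i ≡ j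
      mutual⇒≡ {i} {j} a b (ab , ba) = proj₂ (proj₂ strong) i j
        (mutual⇒⊑ a b (ab , ba)) (mutual⇒⊑ b a (ba , ab))

      -- Maximality also concerns arcs: the class around `a` holds every arc between its vertices
      -- and lies inside `C i`. Hence the diagonal blocks of the adjacency matrix of `D` are those
      -- of the components.
      C-induced : ∀ i a b → Digraph.arc (digraph (C i)) a b ≡ arc (vertex (C i) a) (vertex (C i) b)
      C-induced i a b = ⇔→≡ (mk⇔ (vertex-arc (C i)) reflects)
        where
        reflects : Arc (vertex (C i) a) (vertex (C i) b) → Digraph.Arc (digraph (C i)) a b
        reflects ab with proj₂ (component⊑C i a) _ _
                           (mutual⇒hasArc (vertex (C i) a) (ε , ε) (C-mutual i (a , ≡.refl) (b , ≡.refl)) ab)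
        ... | a′ , b′ , eq , eq′ , a′b′ with vertex-injective (C i) eq | vertex-injective (C i) eq′
        ...   | ≡.refl | ≡.refl = a′b′

      covering : ∀ v → ∃[ i ] HasVertex (C i) v
      covering v with proj₁ (proj₂ strong) (component v) (component-isStrongComponent v)
      ... | i , (vertices , _) , _ = i , vertices v (mutual⇒hasVertex v (ε , ε))

      index : Fin order → Fin k
      index v = proj₁ (covering v)

      index-hasVertex : ∀ v → HasVertex (C (index v)) v
      index-hasVertex v = proj₂ (covering v)

      index-vertex : ∀ i a → index (vertex (C i) a) ≡ i
      index-vertex i a with index-hasVertex (vertex (C i) a)
      ... | b , eq = mutual⇒≡ b a (≡.subst (λ w → Mutual w (vertex (C i) a)) (≡.sym eq) (ε , ε))

      -- The sinks of the condensation are minimal.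
      _≺_ : Rel (Fin k) 0ℓ
      i ≺ j = i ≢ j × ∃[ a ] ∃[ b ] Reaches (vertex (C j) b) (vertex (C i) a)

      _≺?_ : Decidable _≺_
      i ≺? j = ¬? (i ≟ j) ×-dec Fin.any? (λ a → Fin.any? (λ b → reaches? _ _))

      ≺-trans : ∀ {i j l} → i ≺ j → j ≺ l → i ≺ l
      ≺-trans {i} {j} {l} (i≢j , a , b , ji) (j≢l , c , d , lj) = i≢l , a , d , li
        where
        li : Reaches (vertex (C l) d) (vertex (C i) a)
        li = lj ◅◅ proj₁ (C-mutual j (c , ≡.refl) (b , ≡.refl)) ◅◅ ji

        i≢l : i ≢ l
        -- If `l` were `i`, the walks from `l` to `j` and from `j` to `i` would close up and merge
        -- `i` with `j`.
        i≢l ≡.refl = i≢j (mutual⇒≡ a b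
          (proj₁ (C-mutual i (a , ≡.refl) (d , ≡.refl)) ◅◅ lj ◅◅ proj₁ (C-mutual j (c , ≡.refl) (b , ≡.refl)) , ji))

      ≺-isStrictPartialOrder : IsStrictPartialOrder _≡_ _≺_
      ≺-isStrictPartialOrder = record
        { isEquivalence = ≡.isEquivalence
        ; irrefl        = λ i≡j (i≢j , _) → i≢j i≡j
        ; trans         = ≺-trans
        ; <-resp-≈      = ≡.resp₂ _≺_
        }

      arc⇒≺ : ∀ {v w} → index v ≢ index w → Arc v w → index w ≺ index v
      arc⇒≺ {v} {w} v≢w vw with index-hasVertex v | index-hasVertex w
      ... | b , eq | a , eq′ = v≢w ∘ ≡.sym , a , b , ≡.subst₂ Reaches (≡.sym eq) (≡.sym eq′) (vw ◅ ε)

-- The spectrum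

flatten : ∀ {A : Set} {k} (size : Fin k → ℕ) → (∀ i → Vector A (size i)) → Vector A (sumℕ size)
flatten {k = zero}  size xss ()
flatten {k = suc k} size xss = xss zero ++ flatten (size ∘ suc) (λ i → xss (suc i))

module _ (S : CommutativeMonoid 0ℓ 0ℓ) where
  open CommutativeMonoid S
  open Summation S using (sum; sum-cong-≋)

  sum-++ : ∀ m {n} (f : Vector Carrier (m ℕ.+ n)) → sum f ≈ sum (f ∘ (_↑ˡ n)) ∙ sum (f ∘ (m ↑ʳ_))
  sum-++ zero    f = sym (identityˡ _)
  sum-++ (suc m) f = trans (∙-congˡ (sum-++ m (f ∘ suc))) (sym (assoc _ _ _))

  -- The monoid is arbitrary because the lemma serves both the product of linear factors and the sum
  -- over the spectrum.
  sum-flatten : ∀ {A : Set} {k} (size : Fin k → ℕ) (xss : ∀ i → Vector A (size i)) (φ : A → Carrier) →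
                sum (φ ∘ flatten size xss) ≈ sum (λ i → sum (φ ∘ xss i))
  sum-flatten {k = zero}  size xss φ = refl
  sum-flatten {k = suc k} size xss φ = trans (sum-++ (size zero) _) (∙-cong
    (sum-cong-≋ (λ j → reflexive (≡.cong φ (lookup-++ˡ (xss zero) rest j))))
    (trans (sum-cong-≋ (λ j → reflexive (≡.cong φ (lookup-++ʳ (xss zero) rest j))))
           (sum-flatten (size ∘ suc) (λ i → xss (suc i)) φ)))
    where rest = flatten (size ∘ suc) (λ i → xss (suc i))

module Spectrum (R : Reals) where
  open RealProperties R using (complexRing; _≟C_; complex-0≉1; complex-zero-product; complex-avoid)
  open CommutativeRing complexRing hiding (zero)
  open Matrices (complexRawRing R) using (charPoly)
  open BlockTriangular complexRing using (product; product-cong; det-blockTriangular)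
  open Determinants complexRing using (det-cong; Matrix)
  open PolynomialFunctions complexRing using (linearProduct; module InfiniteDomain)
  open InfiniteDomain complex-0≉1 complex-zero-product complex-avoid using (sum-over-roots)
  open Energy R
  open Digraph using (order)
  open SubDigraph using (vertex; vertex-injective)
  open SetoidReasoning setoid

  module _ (D : Digraph) {k} (C : Fin k → SubDigraph D) (strong : AreStrongComponents D C) where
    open Condensation D

    -- Diagonal entries stay inside a component, so an entry between different components comes from
    -- `- A` alone; where it is nonzero there is an arc, and arcs lead downwards in `≺`.
    charPoly-components-dec : Decidable Reaches → ∀ x →
      charPoly (adjacency D) x ≈ product (λ i → charPoly (adjacency (digraph (C i))) x)
    charPoly-components-dec reaches? x = begin
      charPoly (adjacency D) x
        ≈⟨ det-blockTriangular (index reaches? C strong) (λ i → vertex (C i)) (λ i → vertex-injective (C i))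
             (index-vertex reaches? C strong) (index-hasVertex reaches? C strong)
             (≺-isStrictPartialOrder reaches? C strong) (_≺?_ reaches? C strong) xI-A triangular ⟩
      product (λ i → Matrices.det (complexRawRing R) (λ a b → xI-A (vertex (C i) a) (vertex (C i) b)))
        ≈⟨ product-cong {k} (λ i → det-cong {order (digraph (C i))} (block i)) ⟩
      product (λ i → charPoly (adjacency (digraph (C i))) x) ∎
      where
      xI-A : Matrix (order D)
      xI-A v w = (if does (v ≟ w) then x else 0#) + - adjacency D v w

      triangular : ∀ v w → index reaches? C strong v ≢ index reaches? C strong w →
                   ¬ (_≺_ reaches? C strong (index reaches? C strong w) (index reaches? C strong v)) → xI-A v w ≈ 0#
      triangular v w v≢w w⊀v with v ≟ w | Digraph.arc D v w in eq
      ... | yes ≡.refl | _     = contradiction ≡.refl v≢w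
      ... | no _       | true  = contradiction (arc⇒≺ reaches? C strong v≢w eq) w⊀v
      ... | no _       | false = -‿inverseʳ 0#

      block : ∀ i a b → xI-A (vertex (C i) a) (vertex (C i) b) ≈
                        (if does (a ≟ b) then x else 0#) + - adjacency (digraph (C i)) a b
      block i a b = reflexive (≡.cong₂ (λ p q → (if p then x else 0#) + - ((if q then R.1# else R.0#) , R.0#))
          same (≡.sym (C-induced reaches? C strong i a b)))
        where
        module R = Reals R
        same : does (vertex (C i) a ≟ vertex (C i) b) ≡ does (a ≟ b)
        same with a ≟ b
        ... | yes ≡.refl = dec-true (vertex (C i) a ≟ vertex (C i) a) ≡.refl
        ... | no a≢b     = dec-false (vertex (C i) a ≟ vertex (C i) b) (a≢b ∘ vertex-injective (C i))

    -- Equality of complex numbers is decidable, hence stable under double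
    -- negation, so reachability may be assumed decidable.
    charPoly-components : ∀ x →
      charPoly (adjacency D) x ≈ product (λ i → charPoly (adjacency (digraph (C i))) x)
    charPoly-components x = decidable-stable (_ ≟C _)
      (¬¬-map (λ reaches? → charPoly-components-dec reaches? x) reaches-decidable-¬¬)

    module _ (S : CommutativeMonoid 0ℓ 0ℓ) where
      private module S = CommutativeMonoid S
      open Summation S using (sum)

      sum-over-spectrum : ∀ mu → AreEigenvalues (adjacency D) mu →
        (lam : ∀ i → Vector (ℂ R) (order (digraph (C i)))) →
        (∀ i → AreEigenvalues (adjacency (digraph (C i))) (lam i)) →
        (φ : ℂ R → S.Carrier) → (∀ {x y} → x ≈ y → φ x S.≈ φ y) →
        sum (φ ∘ mu) S.≈ sum (λ i → sum (φ ∘ lam i))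
      sum-over-spectrum mu mu-eigen lam lam-eigen φ φ-cong = S.trans
        (sum-over-roots S mu (flatten size lam) equal φ φ-cong)
        (sum-flatten S size lam φ)
        where
        size : Fin k → ℕ
        size i = order (digraph (C i))
        equal : ∀ x → linearProduct mu x ≈ linearProduct (flatten size lam) x
        equal x = begin
          linearProduct mu x                                       ≈⟨ mu-eigen x ⟨
          charPoly (adjacency D) x                                 ≈⟨ charPoly-components x ⟩
          product (λ i → charPoly (adjacency (digraph (C i))) x)   ≈⟨ product-cong {k} (λ i → lam-eigen i x) ⟩
          product (λ i → linearProduct (lam i) x)                  ≈⟨ sum-flatten *-commutativeMonoid size lam (λ z → x + - z) ⟨
          linearProduct (flatten size lam) x                       ∎

-- Comparing the energies

module Deviation (R : Reals) where
  open Reals R hiding (zero)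
  open IsStrictTotalOrder isStrictTotalOrder using (<-respʳ-≈; <-respˡ-≈)
  open RealProperties R
  open IntegerSolver commutativeRing
  open Determinants commutativeRing using (sum-linear)
  open Summation +-commutativeMonoid using (sum-cong-≋; ∑-distrib-+)
  open SetoidReasoning setoid

  -- Once the sign of `p + - b` is known, the left side collapses to `p + - a` or to its negative,
  -- and both are at most the absolute value.
  shift-bound : ∀ p b a → ∣ p + - b ∣ᵣ + (if does (b <? p) then b + - a else - (b + - a)) ≤ ∣ p + - a ∣ᵣ
  shift-bound p b a with b <? p
  ... | yes b<p = ≤-trans (inj₂ (trans (+-congʳ (∣∣-nonneg (inj₁ (difference-positive b<p))))
                    (solve 3 (λ p b a → p :+ :- b :+ (b :+ :- a) := p :+ :- a) refl p b a))) (x≤∣x∣ _)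
  ... | no b≮p  = ≤-trans (inj₂ (trans (+-congʳ (∣∣-nonpos (difference-nonpos (≮⇒≥ b≮p))))
                    (solve 3 (λ p b a → :- (p :+ :- b) :+ :- (b :+ :- a) := :- (p :+ :- a)) refl p b a))) (-x≤∣x∣ _)

  -- With `c` values true there are `m - c` values false, and `c - (m - c)` is the coefficient
  -- `c + c - m`.
  sum-signs : ∀ {m} (β : Fin m → Bool) d →
    sum (λ j → if β j then d else - d) ≈
    ((∣ tabulate β ∣ times 1#) + (∣ tabulate β ∣ times 1#) + - (m times 1#)) * d
  sum-signs {zero}  β d = solve 1 (λ d → con ℤ.0ℤ := (con ℤ.0ℤ :+ con ℤ.0ℤ :+ :- con ℤ.0ℤ) :* d) refl d
  sum-signs {suc m} β d with β zero | sum-signs (β ∘ suc) d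
  -- A leading `true` makes the cardinality a successor, which `times` unfolds to `1# + _`; this is
  -- the constant 1 in the solver expression.
  ... | true  | ih = trans (+-congˡ ih)
    (solve 3 (λ c m d → d :+ (c :+ c :+ :- m) :* d :=
       ((con ℤ.1ℤ :+ c) :+ (con ℤ.1ℤ :+ c) :+ :- (con ℤ.1ℤ :+ m)) :* d) refl (∣ tabulate (β ∘ suc) ∣ times 1#) (m times 1#) d)
  ... | false | ih = trans (+-congˡ ih)
    (solve 3 (λ c m d → :- d :+ (c :+ c :+ :- m) :* d :=
       (c :+ c :+ :- (con ℤ.1ℤ :+ m)) :* d) refl (∣ tabulate (β ∘ suc) ∣ times 1#) (m times 1#) d)

  sum-shift-bound : ∀ {m} (p : Vector Carrier m) b a (let c = ∣ tabulate (λ j → does (b <? p j)) ∣ times 1#) →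
    sum (λ j → ∣ p j + - b ∣ᵣ) + (c + c + - (m times 1#)) * (b + - a) ≤ sum (λ j → ∣ p j + - a ∣ᵣ)
  sum-shift-bound p b a = ≤-trans (inj₂ (begin
      sum (λ j → ∣ p j + - b ∣ᵣ) + _
        ≈⟨ +-congˡ (sum-signs β (b + - a)) ⟨
      sum (λ j → ∣ p j + - b ∣ᵣ) + sum (λ j → if β j then b + - a else - (b + - a))
        ≈⟨ ∑-distrib-+ (λ j → ∣ p j + - b ∣ᵣ) (λ j → if β j then b + - a else - (b + - a)) ⟨
      sum (λ j → ∣ p j + - b ∣ᵣ + (if β j then b + - a else - (b + - a))) ∎))
    (sum-mono-≤ _ _ (λ j → shift-bound (p j) b a))
    where
    β : Fin _ → Bool
    β j = does (b <? p j)

  -- In the application `d i + a` is the loop density of component `i`. The hypotheses on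
  -- `N i * (d i + a)` and `n * a` are the definitions of the densities with denominators cleared.
  sum-weighted-zero : ∀ {k} (N S d : Vector Carrier k) a n s → sum N ≈ n → sum S ≈ s → n * a ≈ s →
                      (∀ i → N i * (d i + a) ≈ S i) → sum (λ i → N i * d i) ≈ 0#
  sum-weighted-zero N S d a n s ΣN ΣS na≈s eq = begin
    Σ                                   ≈⟨ solve 3 (λ a n z → z := (a :* n :+ z) :+ :- (n :* a)) refl a (sum N) Σ ⟩
    a * sum N + Σ + - (sum N * a)       ≈⟨ +-congʳ (sum-linear a S N (λ i → N i * d i) (λ i → trans (sym (eq i))
                                             (solve 3 (λ n d a → n :* (d :+ a) := a :* n :+ n :* d) refl (N i) (d i) a))) ⟨
    sum S + - (sum N * a)               ≈⟨ +-cong ΣS (-‿cong (trans (*-congʳ ΣN) na≈s)) ⟩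
    s + - s                             ≈⟨ -‿inverseʳ s ⟩
    0#                                  ∎
    where Σ = sum (λ i → N i * d i)

  -- Where `p` is false the two terms on the right are negatives of each other and cancel. In the
  -- application the two `sumWhere` terms are the sides of the conclusion.
  split-sum : ∀ {k} (p : Fin k → Bool) (b c : Vector Carrier k) a →
    sumWhere p (λ i → (b i + - a) * c i) ≈
    sum (λ i → (b i + - a) * c i) + sumWhere (not ∘ p) (λ i → (a + - b i) * c i)
  split-sum p b c a = trans (sum-linear 1# _ _ _ term) (+-congʳ (*-identityˡ _))
    where
    term : ∀ i → (if p i then (b i + - a) * c i else 0#) ≈
                 1# * ((b i + - a) * c i) + (if not (p i) then (a + - b i) * c i else 0#)
    term i with p i
    ... | true  = solve 1 (λ x → x := con ℤ.1ℤ :* x :+ con ℤ.0ℤ) refl _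
    ... | false = solve 3 (λ a b c → con ℤ.0ℤ := con ℤ.1ℤ :* ((b :+ :- a) :* c) :+ (a :+ :- b) :* c) refl a (b i) (c i)

  -- The contributions `- N i * d i` add up to zero, so only the doubled counts survive.
  sum-doubled : ∀ {k} (N c d : Vector Carrier k) → sum (λ i → N i * d i) ≈ 0# →
    sum (λ i → (c i + c i + - N i) * d i) ≈ sum (λ i → d i * c i) + sum (λ i → d i * c i)
  sum-doubled N c d zero-sum = sym (begin
    X + X                              ≈⟨ ∑-distrib-+ (λ i → d i * c i) (λ i → d i * c i) ⟨
    sum (λ i → d i * c i + d i * c i)  ≈⟨ sum-cong-≋ (λ i → solve 3 (λ n c d → d :* c :+ d :* c := (c :+ c :+ :- n) :* d :+ n :* d) refl (N i) (c i) (d i)) ⟩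
    sum (λ i → (c i + c i + - N i) * d i + N i * d i)
                                       ≈⟨ ∑-distrib-+ (λ i → (c i + c i + - N i) * d i) (λ i → N i * d i) ⟩
    sum (λ i → (c i + c i + - N i) * d i) + sum (λ i → N i * d i) ≈⟨ +-congˡ zero-sum ⟩
    sum (λ i → (c i + c i + - N i) * d i) + 0#                    ≈⟨ +-identityʳ _ ⟩
    sum (λ i → (c i + c i + - N i) * d i)                         ∎)
    where X = sum (λ i → d i * c i)

  module _ {E E′ X left right} (bound : E′ + (X + X) ≤ E) (split : left ≈ X + right) where

    -- By `split`, the claim is that `X` is at most zero. A positive `X` would put `E` strictly
    -- above `E′`; refuting its sign avoids dividing `X + X` by two.
    conclude-≤ : E ≤ E′ → left ≤ right
    conclude-≤ E≤E′ = ≤-trans (inj₂ (trans split (+-comm X right)))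
      (≤-trans (+-monoʳ-≤ right (≮⇒≥ 0≮X)) (inj₂ (+-identityʳ right)))
      where
      0≮X : ¬ 0# < X
      0≮X 0<X = ≤⇒≯ (≤-trans bound E≤E′)
        (<-respˡ-≈ (+-identityʳ E′) (+-monoʳ-< E′ (positive-+ 0<X (inj₁ 0<X))))

    conclude-< : E < E′ → left < right
    conclude-< E<E′ with X <? 0#
    ... | yes X<0 = <-respˡ-≈ (trans (+-comm right X) (sym split)) (<-respʳ-≈ (+-identityʳ right) (+-monoʳ-< right X<0))
    ... | no X≮0  = contradiction (≤-<-trans bound E<E′) (≤⇒≯
      (≤-trans (inj₂ (solve 1 (λ e → e := e :+ (con ℤ.0ℤ :+ con ℤ.0ℤ)) refl E′))
               (+-monoʳ-≤ E′ (+-mono-≤ (≮⇒≥ X≮0) (≮⇒≥ X≮0)))))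

theorem3p10 :
    (R : Reals) →
    let open Reals R
        open Energy R
        open Digraph
    in
    (D : Digraph) (mu : Vector (ℂ R) (order D)) →
    AreEigenvalues (adjacency D) mu →
    (k : ℕ) (C : Fin k → SubDigraph D) →
    AreStrongComponents D C →
    order D ≡ sumℕ (λ i → order (digraph (C i))) →
    σ D ≡ sumℕ (λ i → σ (digraph (C i))) →
    (lam : (i : Fin k) → Vector (ℂ R) (order (digraph (C i)))) →
    (∀ i → AreEigenvalues (adjacency (digraph (C i))) (lam i)) →
    (l : ℕ) → 1 ℕ.≤ l → l ℕ.< k →
    (∀ i → toℕ i ℕ.< l → loopDensity (digraph (C i)) > loopDensity D) →
    (∀ i → l ℕ.≤ toℕ i → loopDensity (digraph (C i)) ≤ loopDensity D) →
    let totalE = sum (λ i → energy (digraph (C i)) (lam i))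
        cardB  = λ i → ∣ B (digraph (C i)) (lam i) ∣ times 1#
        left   = sumWhere (λ i → toℕ i <ᵇ l)
                   (λ i → (loopDensity (digraph (C i)) + - loopDensity D) * cardB i)
        right  = sumWhere (λ i → not (toℕ i <ᵇ l))
                   (λ i → (loopDensity D + - loopDensity (digraph (C i))) * cardB i)
    in
    (energy D mu ≤ totalE → left ≤ right) ×
    (energy D mu < totalE → left < right)
theorem3p10 R D mu mu-eigen k C strong order-sum σ-sum lam lam-eigen l _ _ _ _ =
  conclude-≤ bound split , conclude-< bound split
  where
  open Reals R hiding (zero)
  open Energy R
  open Digraph using (order; σ; nonEmpty)
  open RealProperties R
  open IntegerSolver commutativeRing
  open Summation +-commutativeMonoid using (∑-distrib-+)
  open Deviation R
  open Spectrum R using (sum-over-spectrum)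

  a : Carrier
  a = loopDensity D

  b N c d : Vector Carrier k
  b i = loopDensity (digraph (C i))
  N i = order (digraph (C i)) times 1#
  c i = ∣ B (digraph (C i)) (lam i) ∣ times 1#
  d i = b i + - a

  E′ X : Carrier
  E′ = sum (λ i → energy (digraph (C i)) (lam i))
  X = sum (λ i → d i * c i)

  balanced : sum (λ i → N i * d i) ≈ 0#
  balanced = sum-weighted-zero N (λ i → σ (digraph (C i)) times 1#) d a (order D times 1#) (σ D times 1#)
    (trans (sum-times (λ i → order (digraph (C i)))) (reflexive (≡.cong (_times 1#) (≡.sym order-sum))))
    (trans (sum-times (λ i → σ (digraph (C i)))) (reflexive (≡.cong (_times 1#) (≡.sym σ-sum))))
    (/ₙ-cancel (σ D) (order D) {{nonEmpty D}})
    (λ i → trans (*-congˡ (solve 2 (λ b a → b :+ :- a :+ a := b) refl (b i) a))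
                 (/ₙ-cancel (σ (digraph (C i))) (order (digraph (C i))) {{nonEmpty (digraph (C i))}}))

  bound : E′ + (X + X) ≤ energy D mu
  bound = ≤-trans (inj₂ (trans (+-congˡ (sym (sum-doubled N c d balanced)))
                               (sym (∑-distrib-+ (λ i → energy (digraph (C i)) (lam i)) (λ i → (c i + c i + - N i) * d i)))))
         (≤-trans (sum-mono-≤ _ _ (λ i → sum-shift-bound (ℜ ∘ lam i) (b i) a))
                  -- Taking the distance of the real part to `a` as `φ` turns the energy of `D` into
                  -- a sum over the eigenvalues of the components, still measured from `a` and not
                  -- from their own densities.
                  (inj₂ (sym (sum-over-spectrum D C strong +-commutativeMonoid mu mu-eigen lam lam-eigen
                                (λ z → ∣ ℜ z + - a ∣ᵣ) (λ (p , _) → ∣∣-cong (+-congʳ p))))))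

  split : sumWhere (λ i → toℕ i <ᵇ l) (λ i → (b i + - a) * c i) ≈
          X + sumWhere (λ i → not (toℕ i <ᵇ l)) (λ i → (a + - b i) * c i)
  split = split-sum (λ i → toℕ i <ᵇ l) b c a
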